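{- For weighted-throughput active-time scheduling on general intervals with unbounded parallelism ($m=\infty$), there is an algorithm with running time polynomial in $n$ and the numeric value of $K$ that returns a schedule of value $\mathrm{ALG}$ satisfying $$\mathrm{ALG}\ge \frac{1-e^{ -1/8}}{\lceil \log_2 K\rceil+1}\,\mathrm{OPT},$$ where $\mathrm{OPT}$ is the optimum value of the instance.
   Context: Weighted-throughput active-time scheduling with unbounded parallelism: an instance consists of a set of $n$ jobs $J=\{1,\dots,n\}$, where job $j$ has an integer release time $r_j$, an integer deadline $d_j$, a positive integer processing time $p_j$ and a nonnegative weight $w_j$, and a positive integer active-time budget $K$. Time slots are integers, and the window of $j$ is the set of slots $W_j=\{r_j,r_j+1,\dots,d_j\}$. Since $m=\infty$, any number of jobs can be processed in an active slot (at most one unit per job per slot), so a schedule is given by a set $A$ of active slots with $|A|\le K$, and job $j$ is completed exactly when $|A\cap W_j|\ge p_j$. The value of $A$ is the total weight of the jobs completed by $A$; $\mathrm{OPT}$ is the maximum value over all $A$ with $|A|\le K$.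
   Formalization: The job weights w_j (and hence OPT and ALG) are nonnegative rational numbers instead of arbitrary nonnegative real numbers. -}

module Defs where

open import Data.Bool using (Bool; true; false; if_then_else_)
open import Data.Integer using (ℤ; +_; -[1+_])
import Data.Integer as ℤ
import Data.Integer.Properties as ℤₚ
open import Data.List using (List; []; _∷_; length; filter; foldr; map; deduplicate)
open import Data.List.Membership.Propositional using (_∈_)
open import Data.List.Relation.Unary.All as All using (All; []; _∷_)
open import Data.Nat using (ℕ; zero; suc; _+_; _*_; _^_; _≤_; NonZero)
import Data.Nat.Properties as ℕₚ
open import Data.Nat.GeneralisedArithmetic using (fold)
open import Data.Nat.Logarithm using (⌈log₂_⌉)
open import Data.Product using (_×_; _,_; proj₁; proj₂; ∃-syntax)
open import Data.Rational using (ℚ; 0ℚ; 1ℚ; _/_)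
import Data.Rational as ℚ
import Data.Rational.Properties as ℚₚ
open import Relation.Binary.PropositionalEquality using (_≡_)
open import Relation.Nullary using (Dec; does)
open import Relation.Nullary.Decidable using (_×-dec_)

record Job : Set where
  field
    release    : ℤ
    deadline   : ℤ
    processing : ℕ
    weight     : ℚ
    processing-positive : NonZero processing
    weight-nonNegative  : 0ℚ ℚ.≤ weight

open Job public

record Instance : Set where
  field
    jobs   : List Job
    budget : ℕ
    budget-positive : NonZero budget

open Instance public

size : Instance → ℕ
size I = length (jobs I)

-- A finite set of slots is presented by a list of its elements; order and
-- repetitions are irrelevant, and `card` counts distinct slots.
Slots : Set
Slots = List ℤ

card : Slots → ℕ
card A = length (deduplicate ℤ._≟_ A)

InWindow : Job → ℤ → Set
InWindow j t = release j ℤ.≤ t × t ℤ.≤ deadline j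

inWindow? : ∀ j t → Dec (InWindow j t)
inWindow? j t = (release j ℤ.≤? t) ×-dec (t ℤ.≤? deadline j)

_∩W_ : Slots → Job → Slots
A ∩W j = filter (inWindow? j) A

Completes : Slots → Job → Set
Completes A j = processing j ≤ card (A ∩W j)

completes? : ∀ A j → Dec (Completes A j)
completes? A j = processing j ℕₚ.≤? card (A ∩W j)

Feasible : Instance → Slots → Set
Feasible I A = card A ≤ budget I

sumℚ : List ℚ → ℚ
sumℚ = foldr ℚ._+_ 0ℚ

value : Instance → Slots → ℚ
value I A = sumℚ (map weight (filter (completes? A) (jobs I)))

IsOPT : Instance → ℚ → Set
IsOPT I v = (∃[ A ] Feasible I A × value I A ≡ v)
          × (∀ A → Feasible I A → value I A ℚ.≤ v)

-- Algorithms are programs of a strict first-order functional language with integers,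
-- rationals, pairs and lists, and a unit cost for each evaluation step.
--
-- Every program terminates, but `loop` iterates any computed number of times,
-- and lists can simulate a memory, so polynomial time is the same notion as for
-- a unit-cost RAM with addition, subtraction and comparison.  Multiplication is
-- deliberately not a primitive: at unit cost it would produce numbers of
-- exponential bit length in polynomially many steps.

data Ty : Set where
  bool int rat : Ty
  _⊗_          : Ty → Ty → Ty
  list         : Ty → Ty

infixr 5 _⊗_

⟦_⟧ : Ty → Set
⟦ bool ⟧   = Bool
⟦ int ⟧    = ℤ
⟦ rat ⟧    = ℚ
⟦ σ ⊗ τ ⟧  = ⟦ σ ⟧ × ⟦ τ ⟧
⟦ list τ ⟧ = List ⟦ τ ⟧

Ctx : Set
Ctx = List Ty

Env : Ctx → Set
Env = All ⟦_⟧

data Tm (Γ : Ctx) : Ty → Set where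
  var              : ∀ {τ} → τ ∈ Γ → Tm Γ τ
  letIn            : ∀ {σ τ} → Tm Γ σ → Tm (σ ∷ Γ) τ → Tm Γ τ
  boolLit          : Bool → Tm Γ bool
  ifte             : ∀ {τ} → Tm Γ bool → Tm Γ τ → Tm Γ τ → Tm Γ τ
  intLit           : ℤ → Tm Γ int
  addℤ subℤ        : Tm Γ int → Tm Γ int → Tm Γ int
  leqℤ             : Tm Γ int → Tm Γ int → Tm Γ bool
  ratLit           : ℚ → Tm Γ rat
  addℚ subℚ        : Tm Γ rat → Tm Γ rat → Tm Γ rat
  leqℚ             : Tm Γ rat → Tm Γ rat → Tm Γ bool
  pair             : ∀ {σ τ} → Tm Γ σ → Tm Γ τ → Tm Γ (σ ⊗ τ)
  fst              : ∀ {σ τ} → Tm Γ (σ ⊗ τ) → Tm Γ σ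
  snd              : ∀ {σ τ} → Tm Γ (σ ⊗ τ) → Tm Γ τ
  nil              : ∀ {τ} → Tm Γ (list τ)
  cons             : ∀ {τ} → Tm Γ τ → Tm Γ (list τ) → Tm Γ (list τ)
  caseList         : ∀ {σ τ} → Tm Γ (list σ) → Tm Γ τ →
                     Tm (σ ∷ list σ ∷ Γ) τ → Tm Γ τ
  -- foldList xs z f: in f, variable 0 is the element, variable 1 the accumulator.
  foldList         : ∀ {σ τ} → Tm Γ (list σ) → Tm Γ τ →
                     Tm (σ ∷ τ ∷ Γ) τ → Tm Γ τ
  -- loop k z f applies f to z max(k,0) times.
  loop             : ∀ {τ} → Tm Γ int → Tm Γ τ → Tm (τ ∷ Γ) τ → Tm Γ τ

iterations : ℤ → ℕ
iterations (+ k)    = k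
iterations -[1+ _ ] = 0

mutual

  eval : ∀ {Γ τ} → Tm Γ τ → Env Γ → ⟦ τ ⟧
  eval (var x)          ρ = All.lookup ρ x
  eval (letIn t u)      ρ = eval u (eval t ρ ∷ ρ)
  eval (boolLit b)      ρ = b
  eval (ifte b t u)     ρ = if eval b ρ then eval t ρ else eval u ρ
  eval (intLit i)       ρ = i
  eval (addℤ t u)       ρ = eval t ρ ℤ.+ eval u ρ
  eval (subℤ t u)       ρ = eval t ρ ℤ.- eval u ρ
  eval (leqℤ t u)       ρ = does (eval t ρ ℤ.≤? eval u ρ)
  eval (ratLit q)       ρ = q
  eval (addℚ t u)       ρ = eval t ρ ℚ.+ eval u ρ
  eval (subℚ t u)       ρ = eval t ρ ℚ.- eval u ρ
  eval (leqℚ t u)       ρ = does (eval t ρ ℚ.≤? eval u ρ)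
  eval (pair t u)       ρ = eval t ρ , eval u ρ
  eval (fst t)          ρ = proj₁ (eval t ρ)
  eval (snd t)          ρ = proj₂ (eval t ρ)
  eval nil              ρ = []
  eval (cons t u)       ρ = eval t ρ ∷ eval u ρ
  eval (caseList t u v) ρ = evalCase u v ρ (eval t ρ)
  eval (foldList t u v) ρ = foldr (evalStep v ρ) (eval u ρ) (eval t ρ)
  eval (loop t u v)     ρ = fold (eval u ρ) (evalBody v ρ) (iterations (eval t ρ))

  evalCase : ∀ {Γ σ τ} → Tm Γ τ → Tm (σ ∷ list σ ∷ Γ) τ → Env Γ → List ⟦ σ ⟧ → ⟦ τ ⟧
  evalCase u v ρ []       = eval u ρ
  evalCase u v ρ (x ∷ xs) = eval v (x ∷ xs ∷ ρ)

  evalStep : ∀ {Γ σ τ} → Tm (σ ∷ τ ∷ Γ) τ → Env Γ → ⟦ σ ⟧ → ⟦ τ ⟧ → ⟦ τ ⟧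
  evalStep v ρ x a = eval v (x ∷ a ∷ ρ)

  evalBody : ∀ {Γ τ} → Tm (τ ∷ Γ) τ → Env Γ → ⟦ τ ⟧ → ⟦ τ ⟧
  evalBody v ρ a = eval v (a ∷ ρ)

foldListCost : ∀ {S T : Set} → (S → T → T) → (S → T → ℕ) → T → List S → ℕ
foldListCost f c z []       = 0
foldListCost f c z (x ∷ xs) = suc (foldListCost f c z xs + c x (foldr f z xs))

loopCost : ∀ {T : Set} → (T → T) → (T → ℕ) → T → ℕ → ℕ
loopCost f c z zero    = 0
loopCost f c z (suc k) = suc (loopCost f c z k + c (fold z f k))

-- Each constructor costs one step plus the cost of the subterms actually
-- evaluated; values are shared, never copied.
mutual

  cost : ∀ {Γ τ} → Tm Γ τ → Env Γ → ℕ
  cost (var x)          ρ = 1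
  cost (letIn t u)      ρ = suc (cost t ρ + cost u (eval t ρ ∷ ρ))
  cost (boolLit b)      ρ = 1
  cost (ifte b t u)     ρ = suc (cost b ρ + (if eval b ρ then cost t ρ else cost u ρ))
  cost (intLit i)       ρ = 1
  cost (addℤ t u)       ρ = suc (cost t ρ + cost u ρ)
  cost (subℤ t u)       ρ = suc (cost t ρ + cost u ρ)
  cost (leqℤ t u)       ρ = suc (cost t ρ + cost u ρ)
  cost (ratLit q)       ρ = 1
  cost (addℚ t u)       ρ = suc (cost t ρ + cost u ρ)
  cost (subℚ t u)       ρ = suc (cost t ρ + cost u ρ)
  cost (leqℚ t u)       ρ = suc (cost t ρ + cost u ρ)
  cost (pair t u)       ρ = suc (cost t ρ + cost u ρ)
  cost (fst t)          ρ = suc (cost t ρ)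
  cost (snd t)          ρ = suc (cost t ρ)
  cost nil              ρ = 1
  cost (cons t u)       ρ = suc (cost t ρ + cost u ρ)
  cost (caseList t u v) ρ = suc (cost t ρ + costCase u v ρ (eval t ρ))
  cost (foldList t u v) ρ =
    suc (cost t ρ + cost u ρ +
         foldListCost (evalStep v ρ) (costStep v ρ) (eval u ρ) (eval t ρ))
  cost (loop t u v)     ρ =
    suc (cost t ρ + cost u ρ +
         loopCost (evalBody v ρ) (costBody v ρ) (eval u ρ) (iterations (eval t ρ)))

  costCase : ∀ {Γ σ τ} → Tm Γ τ → Tm (σ ∷ list σ ∷ Γ) τ → Env Γ → List ⟦ σ ⟧ → ℕ
  costCase u v ρ []       = cost u ρ
  costCase u v ρ (x ∷ xs) = cost v (x ∷ xs ∷ ρ)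

  costStep : ∀ {Γ σ τ} → Tm (σ ∷ τ ∷ Γ) τ → Env Γ → ⟦ σ ⟧ → ⟦ τ ⟧ → ℕ
  costStep v ρ x a = cost v (x ∷ a ∷ ρ)

  costBody : ∀ {Γ τ} → Tm (τ ∷ Γ) τ → Env Γ → ⟦ τ ⟧ → ℕ
  costBody v ρ a = cost v (a ∷ ρ)

-- (release , deadline , processing time , weight)
jobTy : Ty
jobTy = int ⊗ int ⊗ int ⊗ rat

-- One program for all instances: it receives the jobs and the budget and
-- returns a list of active slots.
Algorithm : Set
Algorithm = Tm (list jobTy ∷ int ∷ []) (list int)

encodeJob : Job → ⟦ jobTy ⟧
encodeJob j = release j , deadline j , + processing j , weight j

input : Instance → Env (list jobTy ∷ int ∷ [])
input I = map encodeJob (jobs I) ∷ + budget I ∷ []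

output : Algorithm → Instance → Slots
output alg I = eval alg (input I)

runningTime : Algorithm → Instance → ℕ
runningTime alg I = cost alg (input I)

-- Bounds c·(n + K)^d suffice for arbitrary polynomials in n and K, as K ≥ 1.
PolynomialTime : Algorithm → Set
PolynomialTime alg =
  ∃[ c ] ∃[ d ] ∀ I → runningTime alg I ≤ c * (size I + budget I) ^ d

-- For a convergent sequence a of rationals: lim a ≤ b.
Lim_≤_ : (ℕ → ℚ) → ℚ → Set
Lim a ≤ b = ∀ ε → 0ℚ ℚ.< ε → ∃[ N ] ∀ n → N ≤ n → a n ℚ.≤ b ℚ.+ ε

infix 4 Lim_≤_

-- x ^ i / i !
expTerm : ℚ → ℕ → ℚ
expTerm x zero    = 1ℚ
expTerm x (suc i) = expTerm x i ℚ.* (x ℚ.* (+ 1 / suc i))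

-- Σ_{i < N} x ^ i / i !, converging to e ^ x
expSum : ℚ → ℕ → ℚ
expSum x zero    = 0ℚ
expSum x (suc N) = expSum x N ℚ.+ expTerm x N

-- Rational approximations of (1 - e^(-1/8)) / (⌈log₂ K⌉ + 1)
ratio : ℕ → ℕ → ℚ
ratio K N = (1ℚ ℚ.- expSum (-[1+ 0 ] / 8) N) ℚ.* (+ 1 / suc ⌈log₂ K ⌉)

{-# OPTIONS --safe #-}
module Submission where

open import Defs
open import Algebra.Bundles using (module Ring)
import Algebra.Properties.AbelianGroup as AbelianGroup
import Algebra.Properties.Monoid.Mult as MonoidMult
import Algebra.Properties.Semiring.Mult as SemiringMult
open import Data.Bool using (Bool; true; false; T; T?; not; _∧_; _∨_; if_then_else_)
open import Data.Bool.ListAction using (any)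
open import Data.Bool.Properties using (∨-comm)
open import Data.Empty using (⊥-elim)
open import Data.Integer using (ℤ; +_; -[1+_])
import Data.Integer as ℤ
import Data.Integer.Properties as ℤ
open import Data.Integer.Tactic.RingSolver using (solve-∀)
open import Data.List using (List; []; _∷_; _++_; [_]; length; map; filter; foldr; upTo; deduplicate)
open import Data.List.Membership.Propositional using (_∈_)
open import Data.List.Membership.Propositional.Properties using
  (∈-∃++; ∈-++⁺ˡ; ∈-++⁺ʳ; ∈-++⁻; ∈-map⁺; ∈-map⁻; ∈-upTo⁺; ∈-upTo⁻; ∈-filter⁺; ∈-filter⁻; ∈-deduplicate⁺; ∈-deduplicate⁻)
open import Data.List.Properties using
  (length-map; length-upTo; length-++; length-deduplicate; filter-none; filter-accept; filter-reject)
open import Data.List.Relation.Binary.Permutation.Propositional using (↭-sym)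
open import Data.List.Relation.Binary.Permutation.Propositional.Properties using (∈-resp-↭; ↭-length)
open import Data.List.Relation.Unary.All as All using (All; []; _∷_)
open import Data.List.Relation.Unary.AllPairs using (AllPairs; []; _∷_)
open import Data.List.Relation.Unary.Any using (here; there)
open import Data.List.Relation.Unary.Sorted.TotalOrder.Properties using (Sorted⇒AllPairs)
open import Data.List.Relation.Unary.Unique.DecPropositional.Properties ℤ._≟_ using (deduplicate-!)
open import Data.List.Relation.Unary.Unique.Propositional using (Unique)
import Data.List.Relation.Unary.Unique.Propositional.Properties as Unique
open import Data.List.Sort ℤ.≤-decTotalOrder using (sort; sort-↭; sort-↗)
open import Data.Nat hiding (_*_; _/_)
import Data.Nat as ℕ
open import Data.Nat.GeneralisedArithmetic using (fold)
open import Data.Nat.Induction using (<-rec)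
open import Data.Nat.Logarithm using (⌈log₂_⌉; ⌈log₂⌉-mono-≤; ⌈log₂⌈n/2⌉⌉≡⌈log₂n⌉∸1)
open import Data.Nat.Properties
open import Data.Product using (_×_; _,_; proj₁; proj₂; ∃-syntax)
open import Data.Rational using (ℚ; 0ℚ; 1ℚ; _*_; _/_)
import Data.Rational as ℚ
import Data.Rational.Properties as ℚ
open import Data.Rational.Solver using (module +-*-Solver)
import Data.Rational.Unnormalised as ℚᵘ
import Data.Rational.Unnormalised.Properties as ℚᵘ
open import Data.Sum using (_⊎_; inj₁; inj₂)
open import Data.Unit using (⊤; tt)
open import Function using (_∘_; case_of_)
open import Level using (0ℓ)
open import Relation.Binary.PropositionalEquality using (_≡_; _≢_; refl; sym; trans; cong; cong₂; subst)
open import Relation.Nullary using (Dec; does; yes; no; ¬_; contradiction)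
open import Relation.Nullary.Decidable using (¬?; dec-true; dec-false; _×-dec_)
open import Relation.Unary using (Pred; Decidable)

open MonoidMult ℚ.+-0-monoid using (×-assocˡ) renaming (_×_ to infixr 8 _·_)
open SemiringMult (Ring.semiring ℚ.+-*-ring) using (×-comm-*; ×-assoc-*)
module ℤGroup = AbelianGroup ℤ.+-0-abelianGroup

-- For every L ≤ K the algorithm greedily chooses blocks of L consecutive slots, as
-- many as the budget allows, each maximising the weight of the jobs newly completed;
-- it returns the best of these K schedules.
--
-- Let P be a power of two, and consider the jobs with P ≤ p_j < 2P that an optimal
-- set A completes.  Every P-th element of A gives at most K/P points, and the window
-- of each of these jobs contains one of them.  For L = min(K, 4P), a suitably placed
-- block of length L at a point completes all of these jobs whose window contains it.
-- Hence they are covered by at most 7k blocks, where k is the number of greedy blocks.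
-- The next greedy gain u is at most each of the k gains, and the weight left uncovered
-- by the greedy blocks is at most 7k·u, so the greedy value is at least 1/8 of the weight
-- of the class.  There are at most ⌈log₂ K⌉ + 1 classes, and 1/8 ≥ 1 − e^(−1/8).

-- Running time of programs

-- The completed weight is not submodular in the set of active slots: two blocks may together
-- complete a job that neither completes alone, so a greedy choice by true value has no evident
-- guarantee. Here a block is credited only with the jobs that it completes by itself, in
-- consecutive slots. The credited weight is a weighted coverage function, whose marginal gains only
-- decrease, and it bounds the true value from below. The price is paid in the comparison with the
-- optimum, whose slots may be scattered. Replacing them by few blocks of one length works only for
-- jobs of comparable processing times: the points must be dense enough to hit the windows of the
-- shortest jobs, while each block must be long enough for the longest. Hence the classes, and the
-- logarithm. Trying every L up to K, and not only the useful lengths, avoids computing powers of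
-- two and is affordable because the time may be polynomial in the numeric value of K.

module _ (M : ℕ) where

  -- Only the numbers of iterations need bounds, since every other construct adds one step. A loop
  -- body is bounded only at the values that the loop reaches: its inner folds run over lists inside
  -- the state, whose lengths are controlled by an invariant. Both branches of a conditional are
  -- included, so no case analysis on the data is needed.
  Bounded : ∀ {Γ τ} → Tm Γ τ → Env Γ → Set
  Bounded (var x)          ρ = ⊤
  Bounded (letIn t u)      ρ = Bounded t ρ × Bounded u (eval t ρ ∷ ρ)
  Bounded (boolLit b)      ρ = ⊤
  Bounded (ifte b t u)     ρ = Bounded b ρ × Bounded t ρ × Bounded u ρ
  Bounded (intLit i)       ρ = ⊤
  Bounded (addℤ t u)       ρ = Bounded t ρ × Bounded u ρ
  Bounded (subℤ t u)       ρ = Bounded t ρ × Bounded u ρ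
  Bounded (leqℤ t u)       ρ = Bounded t ρ × Bounded u ρ
  Bounded (ratLit q)       ρ = ⊤
  Bounded (addℚ t u)       ρ = Bounded t ρ × Bounded u ρ
  Bounded (subℚ t u)       ρ = Bounded t ρ × Bounded u ρ
  Bounded (leqℚ t u)       ρ = Bounded t ρ × Bounded u ρ
  Bounded (pair t u)       ρ = Bounded t ρ × Bounded u ρ
  Bounded (fst t)          ρ = Bounded t ρ
  Bounded (snd t)          ρ = Bounded t ρ
  Bounded nil              ρ = ⊤
  Bounded (cons t u)       ρ = Bounded t ρ × Bounded u ρ
  Bounded (caseList t u v) ρ =
    Bounded t ρ × Bounded u ρ × (∀ x xs → Bounded v (x ∷ xs ∷ ρ))
  Bounded (foldList t u v) ρ =
    Bounded t ρ × Bounded u ρ × length (eval t ρ) ≤ M × (∀ x a → Bounded v (x ∷ a ∷ ρ))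
  Bounded (loop t u v)     ρ =
    Bounded t ρ × Bounded u ρ × iterations (eval t ρ) ≤ M ×
    (∀ n → n < iterations (eval t ρ) → Bounded v (fold (eval u ρ) (evalBody v ρ) n ∷ ρ))

-- `coeff` and `degree` depend on the syntax only, so one polynomial serves all instances:
-- sequencing adds coefficients and takes the larger degree, and an iteration raises the degree of
-- its body by one.
coeff : ∀ {Γ τ} → Tm Γ τ → ℕ
coeff (var x)          = 1
coeff (letIn t u)      = suc (coeff t + coeff u)
coeff (boolLit b)      = 1
coeff (ifte b t u)     = suc (coeff b + (coeff t + coeff u))
coeff (intLit i)       = 1
coeff (addℤ t u)       = suc (coeff t + coeff u)
coeff (subℤ t u)       = suc (coeff t + coeff u)
coeff (leqℤ t u)       = suc (coeff t + coeff u)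
coeff (ratLit q)       = 1
coeff (addℚ t u)       = suc (coeff t + coeff u)
coeff (subℚ t u)       = suc (coeff t + coeff u)
coeff (leqℚ t u)       = suc (coeff t + coeff u)
coeff (pair t u)       = suc (coeff t + coeff u)
coeff (fst t)          = suc (coeff t)
coeff (snd t)          = suc (coeff t)
coeff nil              = 1
coeff (cons t u)       = suc (coeff t + coeff u)
coeff (caseList t u v) = suc (coeff t + (coeff u + coeff v))
coeff (foldList t u v) = suc (coeff t + coeff u + suc (coeff v))
coeff (loop t u v)     = suc (coeff t + coeff u + suc (coeff v))

degree : ∀ {Γ τ} → Tm Γ τ → ℕ
degree (var x)          = 0
degree (letIn t u)      = degree t ⊔ degree u
degree (boolLit b)      = 0
degree (ifte b t u)     = degree b ⊔ (degree t ⊔ degree u)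
degree (intLit i)       = 0
degree (addℤ t u)       = degree t ⊔ degree u
degree (subℤ t u)       = degree t ⊔ degree u
degree (leqℤ t u)       = degree t ⊔ degree u
degree (ratLit q)       = 0
degree (addℚ t u)       = degree t ⊔ degree u
degree (subℚ t u)       = degree t ⊔ degree u
degree (leqℚ t u)       = degree t ⊔ degree u
degree (pair t u)       = degree t ⊔ degree u
degree (fst t)          = degree t
degree (snd t)          = degree t
degree nil              = 0
degree (cons t u)       = degree t ⊔ degree u
degree (caseList t u v) = degree t ⊔ (degree u ⊔ degree v)
degree (foldList t u v) = degree t ⊔ degree u ⊔ suc (degree v)
degree (loop t u v)     = degree t ⊔ degree u ⊔ suc (degree v)

foldListCost-≤ : ∀ {S T : Set} (f : S → T → T) (c : S → T → ℕ) {z B} →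
  (∀ x a → c x a ≤ B) → ∀ xs → foldListCost f c z xs ≤ length xs ℕ.* suc B
foldListCost-≤ f c c≤B []       = z≤n
foldListCost-≤ f c {z} {B} c≤B (x ∷ xs) = s≤s (begin
  foldListCost f c z xs + c x (foldr f z xs) ≤⟨ +-mono-≤ (foldListCost-≤ f c c≤B xs) (c≤B _ _) ⟩
  length xs ℕ.* suc B + B                      ≡⟨ +-comm _ B ⟩
  B + length xs ℕ.* suc B                      ∎)
  where open ≤-Reasoning

loopCost-≤ : ∀ {T : Set} (f : T → T) (c : T → ℕ) {z B} k →
  (∀ n → n < k → c (fold z f n) ≤ B) → loopCost f c z k ≤ k ℕ.* suc B
loopCost-≤ f c zero    c≤B = z≤n
loopCost-≤ f c {z} {B} (suc k) c≤B = s≤s (begin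
  loopCost f c z k + c (fold z f k) ≤⟨ +-mono-≤ (loopCost-≤ f c k λ n n<k → c≤B n (m<n⇒m<1+n n<k)) (c≤B k ≤-refl) ⟩
  k ℕ.* suc B + B                     ≡⟨ +-comm _ B ⟩
  B + k ℕ.* suc B                     ∎)
  where open ≤-Reasoning

-- A record instead of the bare inequality lets `c` and `d` be inferred from the type.
record PolyBound (M k c d : ℕ) : Set where
  constructor ⟨_⟩
  field bound : k ≤ c ℕ.* M ^ d

open PolyBound

module _ {M : ℕ} .{{_ : NonZero M}} where

  private
    weaken : ∀ {k c d} d′ → d ≤ d′ → PolyBound M k c d → k ≤ c ℕ.* M ^ d′
    weaken {c = c} d′ d≤d′ h = ≤-trans (bound h) (*-monoʳ-≤ c (^-monoʳ-≤ M d≤d′))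

    none : ∀ {c d} → PolyBound M 0 c d
    none = ⟨ z≤n ⟩

    one : PolyBound M 1 1 0
    one = ⟨ ≤-refl ⟩

    shrink : ∀ {k k′ c d} → k ≤ k′ → PolyBound M k′ c d → PolyBound M k c d
    shrink k≤k′ h = ⟨ ≤-trans k≤k′ (bound h) ⟩

    plus : ∀ {k k′ c c′ d d′} → PolyBound M k c d → PolyBound M k′ c′ d′ →
           PolyBound M (k + k′) (c + c′) (d ⊔ d′)
    plus {c = c} {c′} {d} {d′} h h′ = ⟨ ≤-trans
      (+-mono-≤ (weaken (d ⊔ d′) (m≤m⊔n d d′) h) (weaken (d ⊔ d′) (m≤n⊔m d d′) h′))
      (≤-reflexive (sym (*-distribʳ-+ (M ^ (d ⊔ d′)) c c′))) ⟩

    step : ∀ {k c d} → PolyBound M k c d → PolyBound M (suc k) (suc c) d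
    step = plus one

    times : ∀ {k n c d} → n ≤ M → PolyBound M k c d → PolyBound M (n ℕ.* k) c (suc d)
    times {k} {n} {c} {d} n≤M h = ⟨ begin
      n ℕ.* k             ≤⟨ *-mono-≤ n≤M (bound h) ⟩
      M ℕ.* (c ℕ.* M ^ d)   ≡⟨ *-assoc M c (M ^ d) ⟨
      M ℕ.* c ℕ.* M ^ d     ≡⟨ cong (ℕ._* M ^ d) (*-comm M c) ⟩
      c ℕ.* M ℕ.* M ^ d     ≡⟨ *-assoc c M (M ^ d) ⟩
      c ℕ.* (M ℕ.* M ^ d)   ∎ ⟩
      where open ≤-Reasoning

    branch : ∀ b {k k′ c c′ d d′} → PolyBound M k c d → PolyBound M k′ c′ d′ →
             PolyBound M (if b then k else k′) (c + c′) (d ⊔ d′)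
    branch true  h h′ = shrink (m≤m+n _ 0) (plus h none)
    branch false h h′ = plus none h′

  costBound : ∀ {Γ τ} (t : Tm Γ τ) (ρ : Env Γ) → Bounded M t ρ →
              PolyBound M (cost t ρ) (coeff t) (degree t)

  private
    binary : ∀ {Γ Δ σ τ} (t : Tm Γ σ) (u : Tm Δ τ) {ρ : Env Γ} {ρ′ : Env Δ} →
             Bounded M t ρ → Bounded M u ρ′ →
             PolyBound M (suc (cost t ρ + cost u ρ′)) (suc (coeff t + coeff u)) (degree t ⊔ degree u)
    binary t u bt bu = step (plus (costBound t _ bt) (costBound u _ bu))

    iterated : ∀ {Γ Δ σ σ′ τ} (t : Tm Γ σ) (u : Tm Γ σ′) (v : Tm Δ τ) {ρ : Env Γ} {n k} →
               Bounded M t ρ → Bounded M u ρ → n ≤ M →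
               k ≤ n ℕ.* suc (coeff v ℕ.* M ^ degree v) →
               PolyBound M (suc (cost t ρ + cost u ρ + k))
                           (suc (coeff t + coeff u + suc (coeff v)))
                           (degree t ⊔ degree u ⊔ suc (degree v))
    iterated t u v bt bu n≤M k≤ =
      step (plus (plus (costBound t _ bt) (costBound u _ bu))
                 (shrink k≤ (times n≤M (step {c = coeff v} ⟨ ≤-refl ⟩))))

  costBound (var x)          ρ _ = one
  costBound (letIn t u)      ρ (bt , bu) = binary t u bt bu
  costBound (boolLit b)      ρ _ = one
  costBound (ifte b t u)     ρ (bb , bt , bu) =
    step (plus (costBound b ρ bb)
               (branch (eval b ρ) (costBound t ρ bt) (costBound u ρ bu)))
  costBound (intLit i)       ρ _ = one
  costBound (addℤ t u)       ρ (bt , bu) = binary t u bt bu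
  costBound (subℤ t u)       ρ (bt , bu) = binary t u bt bu
  costBound (leqℤ t u)       ρ (bt , bu) = binary t u bt bu
  costBound (ratLit q)       ρ _ = one
  costBound (addℚ t u)       ρ (bt , bu) = binary t u bt bu
  costBound (subℚ t u)       ρ (bt , bu) = binary t u bt bu
  costBound (leqℚ t u)       ρ (bt , bu) = binary t u bt bu
  costBound (pair t u)       ρ (bt , bu) = binary t u bt bu
  costBound (fst t)          ρ bt = step (costBound t ρ bt)
  costBound (snd t)          ρ bt = step (costBound t ρ bt)
  costBound nil              ρ _ = one
  costBound (cons t u)       ρ (bt , bu) = binary t u bt bu
  costBound (caseList t u v) ρ (bt , bu , bv) =
    step (plus (costBound t ρ bt) (case (eval t ρ)))
    where
    case : ∀ xs → PolyBound M (costCase u v ρ xs) (coeff u + coeff v) (degree u ⊔ degree v)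
    case []       = branch true {k′ = 0} (costBound u ρ bu) (none {d = degree v})
    case (x ∷ xs) = branch false {k = 0} (none {d = degree u}) (costBound v _ (bv x xs))
  costBound (foldList t u v) ρ (bt , bu , n≤M , bv) =
    iterated t u v bt bu n≤M
      (foldListCost-≤ (evalStep v ρ) (costStep v ρ) (λ x a → bound (costBound v _ (bv x a))) (eval t ρ))
  costBound (loop t u v)     ρ (bt , bu , n≤M , bv) =
    iterated t u v bt bu n≤M
      (loopCost-≤ (evalBody v ρ) (costBody v ρ) (iterations (eval t ρ))
        (λ n n< → bound (costBound v _ (bv n n<))))

-- The algorithm

EJob : Set
EJob = ⟦ jobTy ⟧

-- The window of the job and the block {t − L, …, t − 1} share p consecutive slots.
stab : ℤ → ℤ → EJob → Bool
stab L t (r , d , p , w) =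
  if does (p ℤ.≤? L) then
  if does (r ℤ.+ p ℤ.≤? d ℤ.+ + 1) then
  if does (r ℤ.+ p ℤ.≤? t) then
  does (t ℤ.+ p ℤ.≤? d ℤ.+ + 1 ℤ.+ L)
  else false else false else false

end : EJob → ℤ
end (r , d , p , w) = r ℤ.+ p

eweight : EJob → ℚ
eweight (r , d , p , w) = w

-- The fold has the shape of the program `stabbedᵗ`, so that the value of the program is this weight
-- by computation.
mass : ∀ {A : Set} → (A → ℚ) → (A → Bool) → List A → ℚ
mass w f = foldr (λ x a → if f x then w x ℚ.+ a else a) 0ℚ

stabbed : ℤ → ℤ → List EJob → ℚ
stabbed L t = mass eweight (stab L t)

remove : ℤ → ℤ → List EJob → List EJob
remove L t = foldr (λ j js → if stab L t j then js else j ∷ js) []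

better : (ℤ → ℚ) → ℤ → ℤ → ℤ
better f t t′ = if does (f t ℚ.≤? f t′) then t′ else t

-- The ends r + p suffice as candidates: lowering t to the latest end of a job
-- stabbed by the block before t keeps all these jobs stabbed.
best : List EJob → ℤ → List EJob → ℤ
best cs L js = foldr (λ c t → better (λ t → stabbed L t js) (end c) t) (+ 0) cs

-- The second component is t − l ∷ … ∷ t − 1 ∷ A.
emit : ℤ → List ℤ → ℕ → ℤ × List ℤ
emit t A l = fold (t , A) (λ s → proj₁ s ℤ.- + 1 , proj₁ s ℤ.- + 1 ∷ proj₂ s) l

-- ((used slots , uncovered jobs) , (weight of the covered jobs , active slots))
State : Set
State = (ℤ × List EJob) × (ℚ × List ℤ)

block : List EJob → ℤ → State → State
block cs L ((used , js) , (v , A)) =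
  (used ℤ.+ L , remove L t js) , (v ℚ.+ stabbed L t js , proj₂ (emit t A (iterations L)))
  where t = best cs L js

round : List EJob → ℤ → ℤ → State → State
round cs K L s = if does (proj₁ (proj₁ s) ℤ.+ L ℤ.≤? K) then block cs L s else s

round-fits : ∀ cs {K L} s → proj₁ (proj₁ s) ℤ.+ L ℤ.≤ K → round cs K L s ≡ block cs L s
round-fits cs {K} {L} s ≤K =
  cong (λ b → if b then block cs L s else s) (dec-true (proj₁ (proj₁ s) ℤ.+ L ℤ.≤? K) ≤K)

round-full : ∀ cs {K L} s → ¬ proj₁ (proj₁ s) ℤ.+ L ℤ.≤ K → round cs K L s ≡ s
round-full cs {K} {L} s ≰K =
  cong (λ b → if b then block cs L s else s) (dec-false (proj₁ (proj₁ s) ℤ.+ L ℤ.≤? K) ≰K)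

start : List EJob → State
start js = (+ 0 , js) , (0ℚ , [])

-- For `L ≥ 1` every block uses a slot, so `K` rounds exhaust the budget; once a block no longer
-- fits, the remaining rounds change nothing.
greedy : List EJob → ℤ → ℤ → ℚ × List ℤ
greedy js K L = proj₂ (fold (start js) (round js K L) (iterations K))

improve : List EJob → ℤ → ℤ × ℚ × List ℤ → ℤ × ℚ × List ℤ
improve js K (L , b) =
  + 1 ℤ.+ L , (if does (proj₁ g ℚ.≤? proj₁ b) then b else g)
  where g = greedy js K (+ 1 ℤ.+ L)

search : List EJob → ℤ → ℕ → ℤ × ℚ × List ℤ
search js K = fold (+ 0 , 0ℚ , []) (improve js K)

-- The algorithm as a term of the language

v0 : ∀ {Γ : Ctx} {τ} → τ ∈ (τ ∷ Γ)
v0 = here refl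
v1 : ∀ {Γ : Ctx} {σ τ} → τ ∈ (σ ∷ τ ∷ Γ)
v1 = there v0
v2 : ∀ {Γ : Ctx} {σ₀ σ₁ τ} → τ ∈ (σ₀ ∷ σ₁ ∷ τ ∷ Γ)
v2 = there v1
v3 : ∀ {Γ : Ctx} {σ₀ σ₁ σ₂ τ} → τ ∈ (σ₀ ∷ σ₁ ∷ σ₂ ∷ τ ∷ Γ)
v3 = there v2
v4 : ∀ {Γ : Ctx} {σ₀ σ₁ σ₂ σ₃ τ} → τ ∈ (σ₀ ∷ σ₁ ∷ σ₂ ∷ σ₃ ∷ τ ∷ Γ)
v4 = there v3

module _ {Γ : Ctx} where
  -- The program fragments take variables, not terms, as arguments: under a binder a variable is
  -- shifted by `there`, and no renaming of terms is required.
  releaseᵗ deadlineᵗ processingᵗ endᵗ : jobTy ∈ Γ → Tm Γ int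
  releaseᵗ j    = fst (var j)
  deadlineᵗ j   = fst (snd (var j))
  processingᵗ j = fst (snd (snd (var j)))
  endᵗ j        = addℤ (releaseᵗ j) (processingᵗ j)

  weightᵗ : jobTy ∈ Γ → Tm Γ rat
  weightᵗ j = snd (snd (snd (var j)))

  stabᵗ : int ∈ Γ → int ∈ Γ → jobTy ∈ Γ → Tm Γ bool
  stabᵗ L t j =
    ifte (leqℤ (processingᵗ j) (var L))
    (ifte (leqℤ (endᵗ j) (addℤ (deadlineᵗ j) (intLit (+ 1))))
    (ifte (leqℤ (endᵗ j) (var t))
    (leqℤ (addℤ (var t) (processingᵗ j)) (addℤ (addℤ (deadlineᵗ j) (intLit (+ 1))) (var L)))
    (boolLit false)) (boolLit false)) (boolLit false)

module _ {Γ : Ctx} where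
  stabbedᵗ : int ∈ Γ → int ∈ Γ → list jobTy ∈ Γ → Tm Γ rat
  stabbedᵗ L t js = foldList (var js) (ratLit 0ℚ)
    (ifte (stabᵗ (there (there L)) (there (there t)) v0) (addℚ (weightᵗ v0) (var v1)) (var v1))

  removeᵗ : int ∈ Γ → int ∈ Γ → list jobTy ∈ Γ → Tm Γ (list jobTy)
  removeᵗ L t js = foldList (var js) nil
    (ifte (stabᵗ (there (there L)) (there (there t)) v0) (var v1) (cons (var v0) (var v1)))

module _ {Γ : Ctx} where
  bestᵗ : list jobTy ∈ Γ → int ∈ Γ → list jobTy ∈ Γ → Tm Γ int
  bestᵗ cs L js = foldList (var cs) (intLit (+ 0))
    (letIn (endᵗ v0)
      (ifte (leqℚ (stabbedᵗ (there (there (there L))) v0 (there (there (there js))))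
                  (stabbedᵗ (there (there (there L))) v2 (there (there (there js)))))
            (var v2) (var v0)))

  emitᵗ : int ∈ Γ → int ∈ Γ → list int ∈ Γ → Tm Γ (int ⊗ list int)
  emitᵗ L t A = loop (var L) (pair (var t) (var A))
    (letIn (subℤ (fst (var v0)) (intLit (+ 1)))
      (pair (var v0) (cons (var v0) (snd (var v1)))))

stateTy searchTy : Ty
stateTy  = (int ⊗ list jobTy) ⊗ (rat ⊗ list int)
searchTy = int ⊗ (rat ⊗ list int)

-- Variables: state, L, search state, jobs, K.
roundCtx : Ctx
roundCtx = stateTy ∷ int ∷ searchTy ∷ list jobTy ∷ int ∷ []

-- Variables: t, uncovered jobs, state, L, search state, jobs, K.
blockᵗ : Tm (int ∷ list jobTy ∷ roundCtx) stateTy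
blockᵗ = pair
  (pair (addℤ (fst (fst (var v2))) (var v3)) (removeᵗ v3 v0 v1))
  (pair (addℚ (fst (snd (var v2))) (stabbedᵗ v3 v0 v1))
        (letIn (snd (snd (var v2))) (snd (emitᵗ v4 v1 v0))))

roundᵗ : Tm roundCtx stateTy
roundᵗ =
  ifte (leqℤ (addℤ (fst (fst (var v0))) (var v1)) (var v4))
    (letIn (snd (fst (var v0))) (letIn (bestᵗ v4 v2 v0) blockᵗ))
    (var v0)

greedyCtx : Ctx
greedyCtx = int ∷ searchTy ∷ list jobTy ∷ int ∷ []

startᵗ : Tm greedyCtx stateTy
startᵗ = pair (pair (intLit (+ 0)) (var v2)) (pair (ratLit 0ℚ) nil)

greedyᵗ : Tm greedyCtx (rat ⊗ list int)
greedyᵗ = snd (loop (var v3) startᵗ roundᵗ)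

improveᵗ : Tm (searchTy ∷ list jobTy ∷ int ∷ []) searchTy
improveᵗ =
  letIn (addℤ (intLit (+ 1)) (fst (var v0)))
    (letIn greedyᵗ
      (pair (var v1) (ifte (leqℚ (fst (var v0)) (fst (snd (var v2)))) (snd (var v2)) (var v0))))

nothingᵗ : Tm (list jobTy ∷ int ∷ []) searchTy
nothingᵗ = pair (intLit (+ 0)) (pair (ratLit 0ℚ) nil)

searchᵗ : Tm (list jobTy ∷ int ∷ []) searchTy
searchᵗ = loop (var v1) nothingᵗ improveᵗ

algorithm : Algorithm
algorithm = snd (snd searchᵗ)

solution : Instance → ℚ × List ℤ
solution I = proj₂ (search (map encodeJob (jobs I)) (+ budget I) (budget I))

-- Polynomial running time of the algorithm

length-remove : ∀ L t js → length (remove L t js) ≤ length js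
length-remove L t []       = z≤n
length-remove L t (j ∷ js) with stab L t j
... | true  = m≤n⇒m≤1+n (length-remove L t js)
... | false = s≤s (length-remove L t js)

length-round : ∀ cs K L s → length (proj₂ (proj₁ (round cs K L s))) ≤ length (proj₂ (proj₁ s))
length-round cs K L s@((used , js) , _) with does (used ℤ.+ L ℤ.≤? K)
... | true  = length-remove L (best cs L js) js
... | false = ≤-refl

length-greedy : ∀ js K L n → length (proj₂ (proj₁ (fold (start js) (round js K L) n))) ≤ length js
length-greedy js K L zero    = ≤-refl
length-greedy js K L (suc n) =
  ≤-trans (length-round js K L (fold (start js) (round js K L) n)) (length-greedy js K L n)

search-length : ∀ js K n → proj₁ (search js K n) ≡ + n
search-length js K zero    = refl
search-length js K (suc n) = cong (λ L → + 1 ℤ.+ L) (search-length js K n)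

bestᵗ-bounded : ∀ {Γ : Ctx} (cs : list jobTy ∈ Γ) (L : int ∈ Γ) (js : list jobTy ∈ Γ) (ρ : Env Γ) {M} →
                length (All.lookup ρ cs) ≤ M → length (All.lookup ρ js) ≤ M → Bounded M (bestᵗ cs L js) ρ
bestᵗ-bounded cs L js ρ cs≤M js≤M =
  _ , _ , cs≤M , λ c t → _ , ((_ , _ , js≤M , _) , (_ , _ , js≤M , _)) , _

blockᵗ-bounded : ∀ t js s L b cs K {M} → length js ≤ M → iterations L ≤ M →
                 Bounded M blockᵗ (t ∷ js ∷ s ∷ L ∷ b ∷ cs ∷ K ∷ [])
blockᵗ-bounded t js s L b cs K js≤M L≤M =
  (_ , _ , _ , js≤M , _) , (_ , _ , _ , js≤M , _) , _ , _ , _ , L≤M , _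

roundᵗ-bounded : ∀ s L b cs K {M} → length (proj₂ (proj₁ s)) ≤ M → length cs ≤ M → iterations L ≤ M →
                 Bounded M roundᵗ (s ∷ L ∷ b ∷ cs ∷ K ∷ [])
roundᵗ-bounded s L b cs K js≤M cs≤M L≤M =
  _ , (_ , bestᵗ-bounded v4 v2 v0 (proj₂ (proj₁ s) ∷ s ∷ L ∷ b ∷ cs ∷ K ∷ []) cs≤M js≤M
         , blockᵗ-bounded (best cs L (proj₂ (proj₁ s))) (proj₂ (proj₁ s)) s L b cs K js≤M L≤M) , _

-- With `z` and `f` as parameters, the bound on the body can be proved for `round` and `improve`
-- instead of interpreted terms. Both equations hold by `refl` where the lemma is applied, since
-- evaluating the terms yields these functions by computation.
loop-bounded : ∀ {Γ τ M} (t : Tm Γ int) (u : Tm Γ τ) (v : Tm (τ ∷ Γ) τ) (ρ : Env Γ) {z f} →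
               eval u ρ ≡ z → evalBody v ρ ≡ f →
               Bounded M t ρ → Bounded M u ρ → iterations (eval t ρ) ≤ M →
               (∀ n → n < iterations (eval t ρ) → Bounded M v (fold z f n ∷ ρ)) →
               Bounded M (loop t u v) ρ
loop-bounded t u v ρ refl refl bt bu k≤M bv = bt , bu , k≤M , bv

greedyᵗ-bounded : ∀ L b cs K {M} → length cs ≤ M → iterations L ≤ M → iterations K ≤ M →
                  Bounded M greedyᵗ (L ∷ b ∷ cs ∷ K ∷ [])
greedyᵗ-bounded L b cs K cs≤M L≤M K≤M = loop-bounded (var v3) startᵗ roundᵗ (L ∷ b ∷ cs ∷ K ∷ [])
  {z = start cs} {round cs K L} refl refl _ _ K≤M λ n _ →
  roundᵗ-bounded (fold (start cs) (round cs K L) n) L b cs K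
    (≤-trans (length-greedy cs K L n) cs≤M) cs≤M L≤M

improveᵗ-bounded : ∀ s cs K {M} → length cs ≤ M → iterations (+ 1 ℤ.+ proj₁ s) ≤ M → iterations K ≤ M →
                   Bounded M improveᵗ (s ∷ cs ∷ K ∷ [])
improveᵗ-bounded s cs K cs≤M L≤M K≤M = _ , greedyᵗ-bounded (+ 1 ℤ.+ proj₁ s) s cs K cs≤M L≤M K≤M , _

algorithm-bounded : ∀ I → Bounded (size I + budget I) algorithm (input I)
algorithm-bounded I =
  loop-bounded (var v1) nothingᵗ improveᵗ (input I) {f = improve js K} refl refl _ _ (m≤n+m _ _)
    λ n n<K → improveᵗ-bounded (search js K n) js K size≤ (length≤ n n<K) (m≤n+m _ _)
  where
  js = map encodeJob (jobs I)
  K  = + budget I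

  size≤ : length js ≤ size I + budget I
  size≤ = ≤-trans (≤-reflexive (length-map encodeJob (jobs I))) (m≤m+n _ _)

  length≤ : ∀ n → n < budget I → iterations (+ 1 ℤ.+ proj₁ (search js K n)) ≤ size I + budget I
  length≤ n n<K rewrite search-length js K n = ≤-trans n<K (m≤n+m _ _)

bounded⇒polynomialTime : ∀ alg → (∀ I → Bounded (size I + budget I) alg (input I)) → PolynomialTime alg
bounded⇒polynomialTime alg bounded = coeff alg , degree alg , λ I →
  let instance
        _ = budget-positive I
        _ = >-nonZero (≤-trans (>-nonZero⁻¹ (budget I)) (m≤n+m (budget I) (size I)))
  in PolyBound.bound (costBound alg (input I) (bounded I))

algorithm-polynomialTime : PolynomialTime algorithm
algorithm-polynomialTime = bounded⇒polynomialTime algorithm algorithm-bounded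

-- Sets of integers

unique-⊆⇒length-≤ : ∀ {A : Set} {xs ys : List A} → Unique xs → (∀ {x} → x ∈ xs → x ∈ ys) → length xs ≤ length ys
unique-⊆⇒length-≤ {xs = []}     [] ⊆ = z≤n
unique-⊆⇒length-≤ {xs = x ∷ xs} (x∉xs ∷ u) ⊆ with as , bs , refl ← ∈-∃++ (⊆ (here refl)) = begin
  suc (length xs)              ≤⟨ s≤s (unique-⊆⇒length-≤ u (λ y∈xs → drop-x (All.lookup x∉xs y∈xs) (⊆ (there y∈xs)))) ⟩
  suc (length (as ++ bs))      ≡⟨ cong suc (length-++ as) ⟩
  suc (length as + length bs)  ≡⟨ +-suc (length as) (length bs) ⟨
  length as + length (x ∷ bs)  ≡⟨ length-++ as ⟨
  length (as ++ x ∷ bs)        ∎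
  where
  open ≤-Reasoning
  drop-x : ∀ {y} → x ≢ y → y ∈ as ++ [ x ] ++ bs → y ∈ as ++ bs
  drop-x x≢y y∈ with ∈-++⁻ as y∈
  ... | inj₁ y∈as          = ∈-++⁺ˡ y∈as
  ... | inj₂ (here y≡x)    = contradiction (sym y≡x) x≢y
  ... | inj₂ (there y∈bs)  = ∈-++⁺ʳ as y∈bs

length-filter-split : ∀ {A : Set} {P : Pred A 0ℓ} (P? : Decidable P) xs →
                      length (filter P? xs) + length (filter (¬? ∘ P?) xs) ≡ length xs
length-filter-split P? []       = refl
length-filter-split P? (x ∷ xs) with P? x
... | yes _ = cong suc (length-filter-split P? xs)
... | no  _ = trans (+-suc _ _) (cong suc (length-filter-split P? xs))

-- Reduces a linear inequality over ℤ to another one and a ring identity.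
≤-from : ∀ {a b} c d → a ℤ.≤ b → b ℤ.- a ≡ d ℤ.- c → c ℤ.≤ d
≤-from c d a≤b eq = ℤ.0≤i-j⇒j≤i {d} {c} (subst (+ 0 ℤ.≤_) eq (ℤ.i≤j⇒0≤j-i a≤b))

<⇒+1≤ : ∀ {i j} → i ℤ.< j → i ℤ.+ + 1 ℤ.≤ j
<⇒+1≤ {i} i<j = subst (ℤ._≤ _) (ℤ.+-comm (+ 1) i) (ℤ.i<j⇒suc[i]≤j i<j)

≤⇒≡+ : ∀ {a b} → a ℤ.≤ b → ∃[ n ] b ≡ a ℤ.+ + n
≤⇒≡+ {a} {b} a≤b = ℤ.∣ b ℤ.- a ∣ , (begin
  b                              ≡⟨ lemma a b ⟩
  a ℤ.+ (b ℤ.- a)                ≡⟨ cong (λ i → a ℤ.+ i) (ℤ.0≤i⇒+∣i∣≡i (ℤ.i≤j⇒0≤j-i a≤b)) ⟨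
  a ℤ.+ + ℤ.∣ b ℤ.- a ∣          ∎)
  where
  open Relation.Binary.PropositionalEquality.≡-Reasoning
  lemma : ∀ a b → b ≡ a ℤ.+ (b ℤ.- a)
  lemma = solve-∀

range : ℤ → ℕ → List ℤ
range a n = map (λ i → a ℤ.+ + i) (upTo n)

range-unique : ∀ a n → Unique (range a n)
range-unique a n = Unique.map⁺ (λ {i} {j} eq → ℤ.+-injective (ℤGroup.∙-cancelˡ a (+ i) (+ j) eq)) (Unique.upTo⁺ n)

length-range : ∀ a n → length (range a n) ≡ n
length-range a n = trans (length-map _ (upTo n)) (length-upTo n)

∈-range : ∀ {a n x} → a ℤ.≤ x → x ℤ.+ + 1 ℤ.≤ a ℤ.+ + n → x ∈ range a n
∈-range {a} {n} {x} a≤x x<a+n with k , refl ← ≤⇒≡+ a≤x =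
  ∈-map⁺ _ (∈-upTo⁺ (subst (_≤ n) (+-comm k 1) (ℤ.drop‿+≤+ (≤-from (+ (k + 1)) (+ n) x<a+n (lemma a (+ k) (+ n))))))
  where
  lemma : ∀ a k n → a ℤ.+ n ℤ.- (a ℤ.+ k ℤ.+ + 1) ≡ n ℤ.- (k ℤ.+ + 1)
  lemma = solve-∀

unique-length-≤ : ∀ {xs a b} → Unique xs → a ℤ.≤ b → (∀ {x} → x ∈ xs → a ℤ.≤ x × x ℤ.+ + 1 ℤ.≤ b) →
                  a ℤ.+ + length xs ℤ.≤ b
unique-length-≤ {xs} {a} u a≤b inside with n , refl ← ≤⇒≡+ a≤b =
  ℤ.+-monoʳ-≤ a (ℤ.+≤+ (subst (length xs ≤_) (length-range a n)
    (unique-⊆⇒length-≤ u (λ x∈ → ∈-range (proj₁ (inside x∈)) (proj₂ (inside x∈))))))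

card-≥ : ∀ {n} a B → (∀ {x} → a ℤ.≤ x → x ℤ.+ + 1 ℤ.≤ a ℤ.+ + n → x ∈ B) → n ≤ card B
card-≥ {n} a B inside = subst (_≤ card B) (length-range a n)
  (unique-⊆⇒length-≤ (range-unique a n) λ x∈ → case ∈-map⁻ _ x∈ of λ
    { (i , i∈ , refl) → ∈-deduplicate⁺ ℤ._≟_ (inside (ℤ.i≤i+j a (+ i))
        (subst (ℤ._≤ a ℤ.+ + n) (lemma a (+ i)) (ℤ.+-monoʳ-≤ a (ℤ.+≤+ (∈-upTo⁻ i∈))))) })
  where
  lemma : ∀ a i → a ℤ.+ (+ 1 ℤ.+ i) ≡ a ℤ.+ i ℤ.+ + 1
  lemma = solve-∀

emit-position : ∀ t A l → proj₁ (emit t A l) ≡ t ℤ.- + l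
emit-position t A zero    = sym (ℤ.+-identityʳ t)
emit-position t A (suc l) = trans (cong (ℤ._- + 1) (emit-position t A l)) (lemma t (+ l))
  where
  lemma : ∀ t l → t ℤ.- l ℤ.- + 1 ≡ t ℤ.- (+ 1 ℤ.+ l)
  lemma = solve-∀

emit-⊇ : ∀ t {A x} l → x ∈ A → x ∈ proj₂ (emit t A l)
emit-⊇ t zero    x∈A = x∈A
emit-⊇ t (suc l) x∈A = there (emit-⊇ t l x∈A)

length-emit : ∀ t A l → length (proj₂ (emit t A l)) ≡ l + length A
length-emit t A zero    = refl
length-emit t A (suc l) = cong suc (length-emit t A l)

∈-emit : ∀ t A l {x} → t ℤ.- + l ℤ.≤ x → x ℤ.+ + 1 ℤ.≤ t → x ∈ proj₂ (emit t A l)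
∈-emit t A zero {x} t≤x x<t =
  contradiction (≤-from (+ 1) (+ 0) (ℤ.+-mono-≤ t≤x x<t) (lemma t x)) λ { (ℤ.+≤+ ()) }
  where
  lemma : ∀ t x → x ℤ.+ t ℤ.- (t ℤ.- + 0 ℤ.+ (x ℤ.+ + 1)) ≡ + 0 ℤ.- + 1
  lemma = solve-∀
∈-emit t A (suc l) {x} t≤x x<t with t ℤ.- + l ℤ.≤? x
... | yes t-l≤x = there (∈-emit t A l t-l≤x x<t)
... | no  t-l≰x = here (ℤ.≤-antisym
      (≤-from x _ (<⇒+1≤ (ℤ.≰⇒> t-l≰x)) (lemma t (+ l) x _ (emit-position t A l)))
      (subst (ℤ._≤ x) (trans (lemma′ t (+ l)) (cong (ℤ._- + 1) (sym (emit-position t A l)))) t≤x))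
  where
  lemma₀ : ∀ t l x → t ℤ.- l ℤ.- (x ℤ.+ + 1) ≡ t ℤ.- l ℤ.- + 1 ℤ.- x
  lemma₀ = solve-∀
  lemma : ∀ t l x u → u ≡ t ℤ.- l → t ℤ.- l ℤ.- (x ℤ.+ + 1) ≡ u ℤ.- + 1 ℤ.- x
  lemma t l x u refl = lemma₀ t l x
  lemma′ : ∀ t l → t ℤ.- (+ 1 ℤ.+ l) ≡ t ℤ.- l ℤ.- + 1
  lemma′ = solve-∀

-- One element is kept out of `suc p`; the counter `c` is the number of elements still to be
-- skipped.
every : ℕ → ℕ → List ℤ → List ℤ
every p c       []       = []
every p zero    (x ∷ xs) = x ∷ every p p xs
every p (suc c) (x ∷ xs) = every p c xs

-- Each kept element is paid for by itself and the `p` elements skipped before it; of the skips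
-- before the first one, `p - c` are granted in advance. Starting with `c = p` grants nothing, which
-- gives the rounded-down quotient.
length-every : ∀ p c xs → c ≤ p → length (every p c xs) ℕ.* suc p + c ≤ length xs + p
length-every p c       []       c≤p = c≤p
length-every p zero    (x ∷ xs) _   = s≤s (begin
  p + k ℕ.* suc p + 0  ≡⟨ +-identityʳ _ ⟩
  p + k ℕ.* suc p      ≡⟨ +-comm p _ ⟩
  k ℕ.* suc p + p      ≤⟨ length-every p p xs ≤-refl ⟩
  length xs + p        ∎)
  where
  open ≤-Reasoning
  k = length (every p p xs)
length-every p (suc c) (x ∷ xs) c<p = begin
  k ℕ.* suc p + suc c  ≡⟨ +-suc _ c ⟩
  suc (k ℕ.* suc p + c) ≤⟨ s≤s (length-every p c xs (<⇒≤ c<p)) ⟩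
  suc (length xs + p)  ∎
  where
  open ≤-Reasoning
  k = length (every p c xs)

-- The first alternative holds as long as no element of the window has been passed.
every-hits : ∀ j p c {xs} → AllPairs ℤ._≤_ xs →
             p < length (xs ∩W j) × c ≤ p ⊎ c < length (xs ∩W j) × All (release j ℤ.≤_) xs →
             ∃[ q ] q ∈ every p c xs × InWindow j q
every-hits j p c {[]} [] (inj₁ (() , _))
every-hits j p c {[]} [] (inj₂ (() , _))
every-hits j p c {x ∷ xs} (x≤xs ∷ sorted) h = by-position (release j ℤ.≤? x) (x ℤ.≤? deadline j) h
  where
  Hit = λ c ys → ∃[ q ] q ∈ every p c ys × InWindow j q

  -- An element before the window may reset the counter, but never above `p`, and the window loses
  -- no element.
  skip : ∀ c → c ≤ p → p < length (xs ∩W j) → Hit c (x ∷ xs)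
  skip zero    _   p< = case every-hits j p p sorted (inj₁ (p< , ≤-refl)) of λ { (q , q∈ , qj) → q , there q∈ , qj }
  skip (suc c) c<p p< = every-hits j p c sorted (inj₁ (p< , <⇒≤ c<p))

  enter : InWindow j x → ∀ c → c < length ((x ∷ xs) ∩W j) → Hit c (x ∷ xs)
  enter xj zero    _  = x , here refl , xj
  enter xj (suc c) c< = every-hits j p c sorted
    (inj₂ (s≤s⁻¹ (subst (λ ys → suc c < length ys) (filter-accept (inWindow? j) xj) c<) ,
           All.map (ℤ.≤-trans (proj₁ xj)) x≤xs))

  by-position : Dec (release j ℤ.≤ x) → Dec (x ℤ.≤ deadline j) →
    p < length ((x ∷ xs) ∩W j) × c ≤ p ⊎ c < length ((x ∷ xs) ∩W j) × All (release j ℤ.≤_) (x ∷ xs) →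
    Hit c (x ∷ xs)
  by-position (no r≰x)  _         (inj₂ (_ , r≤x ∷ _)) = contradiction r≤x r≰x
  by-position (no r≰x)  _         (inj₁ (p< , c≤p)) =
    skip c c≤p (subst (λ ys → p < length ys) (filter-reject (inWindow? j) (r≰x ∘ proj₁)) p<)
  by-position (yes r≤x) (yes x≤d) (inj₁ (p< , c≤p)) = enter (r≤x , x≤d) c (≤-<-trans c≤p p<)
  by-position (yes r≤x) (yes x≤d) (inj₂ (c< , _))   = enter (r≤x , x≤d) c c<
  by-position (yes r≤x) (no x≰d)  h                 = case subst (λ ys → c < length ys) empty (c< h) of λ ()
    where
    c< : p < length ((x ∷ xs) ∩W j) × c ≤ p ⊎ c < length ((x ∷ xs) ∩W j) × All (release j ℤ.≤_) (x ∷ xs) →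
         c < length ((x ∷ xs) ∩W j)
    c< (inj₁ (p< , c≤p)) = ≤-<-trans c≤p p<
    c< (inj₂ (c< , _))   = c<
    empty : (x ∷ xs) ∩W j ≡ []
    empty = filter-none (inWindow? j)
      ((x≰d ∘ proj₂) ∷ All.map (λ x≤y yj → x≰d (ℤ.≤-trans x≤y (proj₂ yj))) x≤xs)

-- Analysis of the greedy covering

·-monoʳ-≤ : ∀ n {p q} → p ℚ.≤ q → n · p ℚ.≤ n · q
·-monoʳ-≤ zero    p≤q = ℚ.≤-refl
·-monoʳ-≤ (suc n) p≤q = ℚ.+-mono-≤ p≤q (·-monoʳ-≤ n p≤q)

·-monoˡ-≤ : ∀ {m n q} → 0ℚ ℚ.≤ q → m ≤ n → m · q ℚ.≤ n · q
·-monoˡ-≤ {n = zero}  0≤q z≤n = ℚ.≤-refl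
·-monoˡ-≤ {n = suc n} 0≤q z≤n =
  ℚ.≤-trans (ℚ.≤-reflexive (sym (ℚ.+-identityˡ 0ℚ))) (ℚ.+-mono-≤ 0≤q (·-monoˡ-≤ {n = n} 0≤q z≤n))
·-monoˡ-≤ {q = q} 0≤q (s≤s m≤n) = ℚ.+-monoʳ-≤ q (·-monoˡ-≤ 0≤q m≤n)

module _ {A : Set} (w : A → ℚ) where

  mass-cong : ∀ {f g} → (∀ x → f x ≡ g x) → ∀ xs → mass w f xs ≡ mass w g xs
  mass-cong f≗g []       = refl
  mass-cong f≗g (x ∷ xs) = cong₂ (λ b a → if b then w x ℚ.+ a else a) (f≗g x) (mass-cong f≗g xs)

  mass-map : ∀ {B : Set} (h : B → A) f xs → mass w f (map h xs) ≡ mass (w ∘ h) (f ∘ h) xs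
  mass-map h f []       = refl
  mass-map h f (x ∷ xs) = cong (λ a → if f (h x) then w (h x) ℚ.+ a else a) (mass-map h f xs)

  mass-∨ : ∀ (f g : A → Bool) xs → mass w (λ x → f x ∨ g x) xs ≡ mass w f xs ℚ.+ mass w (λ x → not (f x) ∧ g x) xs
  mass-∨ f g []       = refl
  mass-∨ f g (x ∷ xs) with f x | g x
  ... | true  | _     = trans (cong (λ a → w x ℚ.+ a) (mass-∨ f g xs)) (sym (ℚ.+-assoc (w x) _ _))
  ... | false | false = mass-∨ f g xs
  ... | false | true  = begin
    w x ℚ.+ mass w (λ x → f x ∨ g x) xs   ≡⟨ cong (λ a → w x ℚ.+ a) (mass-∨ f g xs) ⟩
    w x ℚ.+ (a ℚ.+ b)                     ≡⟨ ℚ.+-assoc (w x) a b ⟨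
    w x ℚ.+ a ℚ.+ b                       ≡⟨ cong (λ c → c ℚ.+ b) (ℚ.+-comm (w x) a) ⟩
    a ℚ.+ w x ℚ.+ b                       ≡⟨ ℚ.+-assoc a (w x) b ⟩
    a ℚ.+ (w x ℚ.+ b)                     ∎
    where
    open Relation.Binary.PropositionalEquality.≡-Reasoning
    a = mass w f xs
    b = mass w (λ x → not (f x) ∧ g x) xs

  mass-nonNegative : ∀ (f : A → Bool) xs → (∀ {x} → x ∈ xs → 0ℚ ℚ.≤ w x) → 0ℚ ℚ.≤ mass w f xs
  mass-nonNegative f []       0≤w = ℚ.≤-refl
  mass-nonNegative f (x ∷ xs) 0≤w with f x
  ... | true  = ℚ.≤-trans (ℚ.≤-reflexive (sym (ℚ.+-identityˡ 0ℚ)))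
                          (ℚ.+-mono-≤ (0≤w (here refl)) (mass-nonNegative f xs (0≤w ∘ there)))
  ... | false = mass-nonNegative f xs (0≤w ∘ there)

  mass-mono : ∀ (f g : A → Bool) xs → (∀ {x} → x ∈ xs → 0ℚ ℚ.≤ w x) →
              (∀ {x} → x ∈ xs → T (f x) → T (g x)) → mass w f xs ℚ.≤ mass w g xs
  mass-mono f g []       0≤w f⇒g = ℚ.≤-refl
  mass-mono f g (x ∷ xs) 0≤w f⇒g with f x | g x | f⇒g (here refl)
  ... | false | false | _  = mass-mono f g xs (0≤w ∘ there) (f⇒g ∘ there)
  ... | false | true  | _  =
    ℚ.≤-trans (ℚ.≤-reflexive (sym (ℚ.+-identityˡ _)))
              (ℚ.+-mono-≤ (0≤w (here refl)) (mass-mono f g xs (0≤w ∘ there) (f⇒g ∘ there)))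
  ... | true  | true  | _  = ℚ.+-monoʳ-≤ (w x) (mass-mono f g xs (0≤w ∘ there) (f⇒g ∘ there))
  ... | true  | false | tt⇒ = ⊥-elim (tt⇒ tt)

  mass-cover : ∀ (f g h : A → Bool) xs → (∀ {x} → x ∈ xs → 0ℚ ℚ.≤ w x) →
               (∀ {x} → x ∈ xs → T (f x) → T (g x) ⊎ T (h x)) →
               mass w f xs ℚ.≤ mass w g xs ℚ.+ mass w h xs
  mass-cover f g h xs 0≤w f⇒g⊎h = begin
    mass w f xs                                        ≤⟨ mass-mono f (λ x → g x ∨ h x) xs 0≤w (λ x∈ → or _ _ ∘ f⇒g⊎h x∈) ⟩
    mass w (λ x → g x ∨ h x) xs                        ≡⟨ mass-∨ g h xs ⟩
    mass w g xs ℚ.+ mass w (λ x → not (g x) ∧ h x) xs  ≤⟨ ℚ.+-monoʳ-≤ (mass w g xs) (mass-mono _ h xs 0≤w λ _ → and _ _) ⟩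
    mass w g xs ℚ.+ mass w h xs                        ∎
    where
    open ℚ.≤-Reasoning
    or : ∀ a b → T a ⊎ T b → T (a ∨ b)
    or true  b     _        = tt
    or false true  _        = tt
    or false false (inj₁ ())
    or false false (inj₂ ())
    and : ∀ a b → T (not a ∧ b) → T b
    and false b t = t

covered : ℤ → List ℤ → EJob → Bool
covered L S j = any (λ t → stab L t j) S

uncovered : ℤ → List ℤ → List EJob → List EJob
uncovered L S js = foldr (remove L) js S

mass-remove : ∀ f L t js → mass eweight f (remove L t js) ≡ mass eweight (λ j → not (stab L t j) ∧ f j) js
mass-remove f L t []       = refl
mass-remove f L t (j ∷ js) with stab L t j
... | true  = mass-remove f L t js
... | false = cong (λ a → if f j then eweight j ℚ.+ a else a) (mass-remove f L t js)

-- Turning the removal of jobs into a Boolean condition makes the residual weights for different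
-- sets of blocks comparable, as masses over one fixed list.
mass-uncovered : ∀ f L S js → mass eweight f (uncovered L S js) ≡ mass eweight (λ j → not (covered L S j) ∧ f j) js
mass-uncovered f L []      js = refl
mass-uncovered f L (t ∷ S) js = begin
  mass eweight f (remove L t (uncovered L S js))                          ≡⟨ mass-remove f L t (uncovered L S js) ⟩
  mass eweight (λ j → not (stab L t j) ∧ f j) (uncovered L S js)          ≡⟨ mass-uncovered _ L S js ⟩
  mass eweight (λ j → not (covered L S j) ∧ not (stab L t j) ∧ f j) js    ≡⟨ mass-cong eweight (λ j → deMorgan (stab L t j) (covered L S j) (f j)) js ⟩
  mass eweight (λ j → not (covered L (t ∷ S) j) ∧ f j) js                 ∎
  where
  open Relation.Binary.PropositionalEquality.≡-Reasoning
  deMorgan : ∀ a b c → not b ∧ not a ∧ c ≡ not (a ∨ b) ∧ c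
  deMorgan true  true  c = refl
  deMorgan true  false c = refl
  deMorgan false b     c = refl

-- The window [r, d + 1) and the block [t - L, t) share min(d + 1, t) - max(r, t - L) slots. This is
-- at least p exactly if all four differences of an upper and a lower endpoint are at least p.
record Stab (L t : ℤ) (j : EJob) : Set where
  constructor stabs
  field
    short  : proj₁ (proj₂ (proj₂ j)) ℤ.≤ L
    wide   : end j ℤ.≤ proj₁ (proj₂ j) ℤ.+ + 1
    early  : end j ℤ.≤ t
    late   : t ℤ.+ proj₁ (proj₂ (proj₂ j)) ℤ.≤ proj₁ (proj₂ j) ℤ.+ + 1 ℤ.+ L

stab⇒Stab : ∀ {L t} j → T (stab L t j) → Stab L t j
stab⇒Stab {L} {t} (r , d , p , w) h
  with p ℤ.≤? L | r ℤ.+ p ℤ.≤? d ℤ.+ + 1 | r ℤ.+ p ℤ.≤? t | t ℤ.+ p ℤ.≤? d ℤ.+ + 1 ℤ.+ L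
... | yes a | yes b | yes c | yes e = stabs a b c e

Stab⇒stab : ∀ {L t} j → Stab L t j → T (stab L t j)
Stab⇒stab {L} {t} (r , d , p , w) (stabs a b c e)
  with p ℤ.≤? L | r ℤ.+ p ℤ.≤? d ℤ.+ + 1 | r ℤ.+ p ℤ.≤? t | t ℤ.+ p ℤ.≤? d ℤ.+ + 1 ℤ.+ L
... | yes _ | yes _ | yes _ | yes _ = tt
... | no ¬a | _     | _     | _     = ¬a a
... | yes _ | no ¬b | _     | _     = ¬b b
... | yes _ | yes _ | no ¬c | _     = ¬c c
... | yes _ | yes _ | yes _ | no ¬e = ¬e e

latest : ∀ L t js → (∀ {j} → j ∈ js → ¬ T (stab L t j)) ⊎
         ∃[ c ] c ∈ js × T (stab L t c) × (∀ {j} → j ∈ js → T (stab L t j) → end j ℤ.≤ end c)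
latest L t [] = inj₁ λ ()
latest L t (j ∷ js) with T? (stab L t j) | latest L t js
... | no ¬sj | inj₁ none = inj₁ λ { (here refl) → ¬sj ; (there j∈) → none j∈ }
... | no ¬sj | inj₂ (c , c∈ , sc , max) =
  inj₂ (c , there c∈ , sc , λ { (here refl) sj → contradiction sj ¬sj ; (there i∈) → max i∈ })
... | yes sj | inj₁ none =
  inj₂ (j , here refl , sj , λ { (here refl) _ → ℤ.≤-refl ; (there i∈) si → contradiction si (none i∈) })
... | yes sj | inj₂ (c , c∈ , sc , max) with ℤ.≤-total (end j) (end c)
...   | inj₁ j≤c = inj₂ (c , there c∈ , sc , λ { (here refl) _ → j≤c ; (there i∈) → max i∈ })
...   | inj₂ c≤j = inj₂ (j , here refl , sj , λ { (here refl) _ → ℤ.≤-refl ; (there i∈) si → ℤ.≤-trans (max i∈ si) c≤j })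

better-≥ : ∀ (f : ℤ → ℚ) t t′ → f t ℚ.≤ f (better f t t′) × f t′ ℚ.≤ f (better f t t′)
better-≥ f t t′ = chosen (f t ℚ.≤? f t′)
  where
  chosen : (t≤t′? : Dec (f t ℚ.≤ f t′)) → let b = if does t≤t′? then t′ else t in f t ℚ.≤ f b × f t′ ℚ.≤ f b
  chosen (yes ≤) = ≤ , ℚ.≤-refl
  chosen (no ≰)  = ℚ.≤-refl , ℚ.<⇒≤ (ℚ.≰⇒> ≰)

best-end : ∀ cs L js {c} → c ∈ cs → stabbed L (end c) js ℚ.≤ stabbed L (best cs L js) js
best-end (c ∷ cs) L js (here refl) = proj₁ (better-≥ (λ t → stabbed L t js) (end c) (best cs L js))
best-end (c ∷ cs) L js (there c∈)  =
  ℚ.≤-trans (best-end cs L js c∈) (proj₂ (better-≥ (λ t → stabbed L t js) (end c) (best cs L js)))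

module Greedy (js : List EJob) (0≤weight : ∀ {j} → j ∈ js → 0ℚ ℚ.≤ eweight j) (l : ℕ) where

  L : ℤ
  L = + l

  residual : List ℤ → ℤ → ℚ
  residual S t = stabbed L t (uncovered L S js)

  residual-mass : ∀ S t → residual S t ≡ mass eweight (λ j → not (covered L S j) ∧ stab L t j) js
  residual-mass S t = mass-uncovered (stab L t) L S js

  pick : List ℤ → ℤ
  pick S = best js L (uncovered L S js)

  residual-nonNegative : ∀ S t → 0ℚ ℚ.≤ residual S t
  residual-nonNegative S t = subst (0ℚ ℚ.≤_) (sym (residual-mass S t)) (mass-nonNegative eweight _ js 0≤weight)

  residual-mono : ∀ S t t′ → (∀ {j} → j ∈ js → T (stab L t j) → T (stab L t′ j)) → residual S t ℚ.≤ residual S t′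
  residual-mono S t t′ t⇒t′ = begin
    residual S t                                                   ≡⟨ residual-mass S t ⟩
    mass eweight (λ j → not (covered L S j) ∧ stab L t j) js       ≤⟨ mass-mono eweight _ _ js 0≤weight (λ {j} j∈ → and (not (covered L S j)) (t⇒t′ j∈)) ⟩
    mass eweight (λ j → not (covered L S j) ∧ stab L t′ j) js      ≡⟨ residual-mass S t′ ⟨
    residual S t′                                                  ∎
    where
    open ℚ.≤-Reasoning
    and : ∀ a {b c} → (T b → T c) → T (a ∧ b) → T (a ∧ c)
    and true b⇒c = b⇒c

  open Stab

  residual-≤-pick : ∀ S t → residual S t ℚ.≤ residual S (pick S)
  residual-≤-pick S t with latest L t js
  -- A block that stabs no job is matched by any position, including the default `+ 0` of `best`.
  ... | inj₁ none = residual-mono S t (pick S) λ j∈ sj → contradiction sj (none j∈)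
  ... | inj₂ (c , c∈ , sc , max) = ℚ.≤-trans
    (residual-mono S t (end c) λ {j} j∈ sj → let s = stab⇒Stab j sj in
      Stab⇒stab j (stabs (short s) (wide s) (max j∈ sj)
        (ℤ.≤-trans (ℤ.+-monoˡ-≤ _ (early (stab⇒Stab c sc))) (late s))))
    (best-end js L (uncovered L S js) c∈)

  residual-∷ : ∀ S t t′ → residual (t′ ∷ S) t ℚ.≤ residual S t
  residual-∷ S t t′ = begin
    residual (t′ ∷ S) t                                              ≡⟨ residual-mass (t′ ∷ S) t ⟩
    mass eweight (λ j → not (covered L (t′ ∷ S) j) ∧ stab L t j) js  ≤⟨ mass-mono eweight _ _ js 0≤weight (λ {j} _ → or (stab L t′ j) (covered L S j)) ⟩
    mass eweight (λ j → not (covered L S j) ∧ stab L t j) js         ≡⟨ residual-mass S t ⟨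
    residual S t                                                     ∎
    where
    open ℚ.≤-Reasoning
    or : ∀ a b {c} → T (not (a ∨ b) ∧ c) → T (not b ∧ c)
    or false b h = h

  gain : List ℤ → ℚ
  gain []      = 0ℚ
  gain (t ∷ S) = gain S ℚ.+ residual S t

  gain-mass : ∀ S → gain S ≡ mass eweight (covered L S) js
  gain-mass []      = sym (none js)
    where
    none : ∀ js → mass eweight (λ _ → false) js ≡ 0ℚ
    none []       = refl
    none (j ∷ js) = none js
  gain-mass (t ∷ S) = begin
    gain S ℚ.+ residual S t                                     ≡⟨ cong₂ ℚ._+_ (gain-mass S) (residual-mass S t) ⟩
    mass eweight (covered L S) js ℚ.+
      mass eweight (λ j → not (covered L S j) ∧ stab L t j) js  ≡⟨ mass-∨ eweight (covered L S) (stab L t) js ⟨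
    mass eweight (λ j → covered L S j ∨ stab L t j) js          ≡⟨ mass-cong eweight (λ j → ∨-comm (covered L S j) (stab L t j)) js ⟩
    mass eweight (covered L (t ∷ S)) js                         ∎
    where open Relation.Binary.PropositionalEquality.≡-Reasoning

  data Picked : List ℤ → Set where
    []  : Picked []
    _∷_ : ∀ {t S} → t ≡ pick S → Picked S → Picked (t ∷ S)

  -- When a block was picked, it gained at least what the block at `t` would have gained then, and
  -- by `residual-∷` the residual at `t` has only decreased since.
  picked-gain : ∀ {S} → Picked S → ∀ t → length S · residual S t ℚ.≤ gain S
  picked-gain []                t = ℚ.≤-refl
  picked-gain {_ ∷ S} (refl ∷ ps) t = begin
    residual S′ t ℚ.+ length S · residual S′ t  ≤⟨ ℚ.+-mono-≤ (ℚ.≤-trans (residual-∷ S t (pick S)) (residual-≤-pick S t))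
                                                     (·-monoʳ-≤ (length S) (residual-∷ S t (pick S))) ⟩
    residual S (pick S) ℚ.+ length S · residual S t  ≤⟨ ℚ.+-monoʳ-≤ (residual S (pick S)) (picked-gain ps t) ⟩
    residual S (pick S) ℚ.+ gain S                   ≡⟨ ℚ.+-comm (residual S (pick S)) (gain S) ⟩
    gain S ℚ.+ residual S (pick S)                   ∎
    where
    open ℚ.≤-Reasoning
    S′ = pick S ∷ S

  covered-uncovered : ∀ S Q {u} → (∀ t → residual S t ℚ.≤ u) →
    mass eweight (λ j → not (covered L S j) ∧ covered L Q j) js ℚ.≤ length Q · u
  covered-uncovered S []      ≤u = ℚ.≤-trans (mass-mono eweight _ (λ _ → false) js 0≤weight (λ {j} _ → and (covered L S j)))
                                             (ℚ.≤-reflexive (sym (gain-mass [])))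
    where
    and : ∀ a → T (not a ∧ false) → T false
    and false ()
    and true ()
  covered-uncovered S (t ∷ Q) {u} ≤u = ℚ.≤-trans
    (mass-cover eweight _ (λ j → not (covered L S j) ∧ stab L t j) (λ j → not (covered L S j) ∧ covered L Q j)
      js 0≤weight (λ {j} _ → either (covered L S j) (stab L t j)))
    (ℚ.+-mono-≤ (subst (ℚ._≤ u) (residual-mass S t) (≤u t)) (covered-uncovered S Q ≤u))
    where
    either : ∀ a b {c} → T (not a ∧ (b ∨ c)) → T (not a ∧ b) ⊎ T (not a ∧ c)
    either false true  _ = inj₁ tt
    either false false h = inj₂ h

  -- Every residual is at most u, the one of the next pick, and each of the picks gained at least u.
  picked-approximation : ∀ {S} → Picked S → ∀ Q → length Q ≤ 7 ℕ.* length S →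
                         mass eweight (covered L Q) js ℚ.≤ 8 · gain S
  picked-approximation {S} ps Q ∣Q∣≤7∣S∣ = begin
    mass eweight (covered L Q) js           ≤⟨ mass-cover eweight _ (covered L S) (λ j → not (covered L S j) ∧ covered L Q j)
                                                 js 0≤weight (λ {j} _ → split (covered L S j)) ⟩
    mass eweight (covered L S) js ℚ.+ mass eweight (λ j → not (covered L S j) ∧ covered L Q j) js
                                            ≤⟨ ℚ.+-mono-≤ (ℚ.≤-reflexive (sym (gain-mass S))) (covered-uncovered S Q (residual-≤-pick S)) ⟩
    gain S ℚ.+ length Q · u                 ≤⟨ ℚ.+-monoʳ-≤ (gain S) (·-monoˡ-≤ (residual-nonNegative S (pick S)) ∣Q∣≤7∣S∣) ⟩
    gain S ℚ.+ (7 ℕ.* length S) · u         ≡⟨ cong (λ a → gain S ℚ.+ a) (×-assocˡ u 7 (length S)) ⟨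
    gain S ℚ.+ 7 · (length S · u)           ≤⟨ ℚ.+-monoʳ-≤ (gain S) (·-monoʳ-≤ 7 (picked-gain ps (pick S))) ⟩
    8 · gain S                              ∎
    where
    open ℚ.≤-Reasoning
    u = residual S (pick S)
    split : ∀ a {b} → T b → T a ⊎ T (not a ∧ b)
    split true  _ = inj₁ tt
    split false h = inj₂ h

  blocks : List ℤ → List ℤ
  blocks []      = []
  blocks (t ∷ S) = proj₂ (emit t (blocks S) l)

  length-blocks : ∀ S → length (blocks S) ≡ length S ℕ.* l
  length-blocks []      = refl
  length-blocks (t ∷ S) = trans (length-emit t (blocks S) l) (cong (λ m → l + m) (length-blocks S))

  state : List ℤ → State
  state S = (+ (length S ℕ.* l) , uncovered L S js) , (gain S , blocks S)

  -- `exhaustive` says that either all `n` rounds placed a block or no further block fits. For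
  -- `n = K` each alternative bounds the number of blocks from below, which the comparison with the
  -- optimum requires.
  record Run (K n : ℕ) (s : State) : Set where
    field
      ends       : List ℤ
      is-state   : s ≡ state ends
      picked     : Picked ends
      within     : length ends ℕ.* l ≤ K
      exhaustive : length ends ≡ n ⊎ K < l + length ends ℕ.* l

  run-round : ∀ {K n s} → Run K n s → Run K (suc n) (round js (+ K) L s)
  run-round {K} {n} {s} r = by-room (+ (length S ℕ.* l) ℤ.+ + l ℤ.≤? + K)
    where
    open Run r renaming (ends to S)
    by-room : Dec (+ (length S ℕ.* l) ℤ.+ + l ℤ.≤ + K) → Run K (suc n) (round js (+ K) L s)
    by-room (yes used≤K) = record
      { ends       = pick S ∷ S
      ; is-state   = begin
          round js (+ K) L s          ≡⟨ cong (round js (+ K) L) is-state ⟩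
          round js (+ K) L (state S)  ≡⟨ round-fits js (state S) used≤K ⟩
          block js L (state S)        ≡⟨ cong (λ m → (+ m , uncovered L (pick S ∷ S) js) , gain (pick S ∷ S) , blocks (pick S ∷ S))
                                           (+-comm (length S ℕ.* l) l) ⟩
          state (pick S ∷ S)          ∎
      ; picked     = refl ∷ picked
      ; within     = subst (_≤ K) (+-comm (length S ℕ.* l) l) (ℤ.drop‿+≤+ used≤K)
      ; exhaustive = case exhaustive of λ
        { (inj₁ ≡n)   → inj₁ (cong suc ≡n)
        ; (inj₂ K<)   → contradiction (ℤ.drop‿+≤+ used≤K) (<⇒≱ (subst (K <_) (+-comm l _) K<)) }
      }
      where open Relation.Binary.PropositionalEquality.≡-Reasoning
    by-room (no used≰K) = record
      { ends       = S
      ; is-state   = trans (cong (round js (+ K) L) is-state) (round-full js (state S) used≰K)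
      ; picked     = picked
      ; within     = within
      ; exhaustive = inj₂ (subst (K <_) (+-comm _ l) (≰⇒> (used≰K ∘ ℤ.+≤+)))
      }

  run : ∀ K n → Run K n (fold (start js) (round js (+ K) L) n)
  run K zero    = record { ends = [] ; is-state = refl ; picked = [] ; within = z≤n ; exhaustive = inj₁ refl }
  run K (suc n) = run-round (run K n)

-- Numerical estimates

n≤2^⌈log₂n⌉ : ∀ n → n ≤ 2 ^ ⌈log₂ n ⌉
n≤2^⌈log₂n⌉ = <-rec _ λ
  { zero          _   → z≤n
  ; (suc zero)    _   → s≤s z≤n
  ; n@(suc (suc m)) rec → let 1≤log = ⌈log₂⌉-mono-≤ {2} {n} (s≤s (s≤s z≤n)) in begin
      n                                ≡⟨ ⌊n/2⌋+⌈n/2⌉≡n n ⟨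
      ⌊ n /2⌋ + ⌈ n /2⌉                ≤⟨ +-monoˡ-≤ ⌈ n /2⌉ (⌊n/2⌋≤⌈n/2⌉ n) ⟩
      ⌈ n /2⌉ + ⌈ n /2⌉                ≡⟨ cong (λ k → ⌈ n /2⌉ + k) (+-identityʳ ⌈ n /2⌉) ⟨
      2 ℕ.* ⌈ n /2⌉                    ≤⟨ *-monoʳ-≤ 2 (rec (⌈n/2⌉<n m)) ⟩
      2 ^ suc ⌈log₂ ⌈ n /2⌉ ⌉          ≡⟨ cong (λ k → 2 ^ suc k) (⌈log₂⌈n/2⌉⌉≡⌈log₂n⌉∸1 n) ⟩
      2 ^ suc (⌈log₂ n ⌉ ∸ 1)          ≡⟨ cong (λ k → 2 ^ k) (m+[n∸m]≡n 1≤log) ⟩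
      2 ^ ⌈log₂ n ⌉                    ∎
  }
  where open ≤-Reasoning

-- The operation `/` normalises by a greatest common divisor, which does not compute for a variable
-- denominator; hence the detour through unnormalised rationals.
unit-fraction-sum : ∀ n → suc n · (+ 1 / suc n) ≡ 1ℚ
unit-fraction-sum n = ℚ.toℚᵘ-injective (ℚᵘ.≃-trans (multiple (suc n)) (ℚᵘ.*≡* (ℤ.*-comm (+ suc n) (+ 1))))
  where
  multiple : ∀ k → ℚ.toℚᵘ (k · (+ 1 / suc n)) ℚᵘ.≃ ℚᵘ.mkℚᵘ (+ k) n
  multiple zero    = ℚᵘ.*≡* refl
  multiple (suc k) = begin
    ℚ.toℚᵘ (+ 1 / suc n ℚ.+ k · (+ 1 / suc n))            ≈⟨ ℚ.toℚᵘ-homo-+ (+ 1 / suc n) (k · (+ 1 / suc n)) ⟩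
    ℚ.toℚᵘ (+ 1 / suc n) ℚᵘ.+ ℚ.toℚᵘ (k · (+ 1 / suc n))  ≈⟨ ℚᵘ.+-cong (ℚ.toℚᵘ-fromℚᵘ (ℚᵘ.mkℚᵘ (+ 1) n)) (multiple k) ⟩
    ℚᵘ.mkℚᵘ (+ 1) n ℚᵘ.+ ℚᵘ.mkℚᵘ (+ k) n                  ≈⟨ ℚᵘ.*≡* (lemma (+ k) (+ suc n)) ⟩
    ℚᵘ.mkℚᵘ (+ suc k) n                                   ∎
    where
    open import Relation.Binary.Reasoning.Setoid ℚᵘ.≃-setoid
    lemma : ∀ k d → (+ 1 ℤ.* d ℤ.+ k ℤ.* d) ℤ.* d ≡ (+ 1 ℤ.+ k) ℤ.* (d ℤ.* d)
    lemma = solve-∀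

unit-fraction-≥0 : ∀ n → 0ℚ ℚ.≤ + 1 / suc n
unit-fraction-≥0 n = ℚ.nonNegative⁻¹ (+ 1 / suc n) ⦃ ℚ.normalize-nonNeg 1 (suc n) ⦄

unit-fraction-cancel : ∀ n q → + 1 / suc n ℚ.* (suc n · q) ≡ q
unit-fraction-cancel n q = begin
  + 1 / suc n ℚ.* (suc n · q)    ≡⟨ ×-comm-* (suc n) (+ 1 / suc n) q ⟩
  suc n · (+ 1 / suc n ℚ.* q)    ≡⟨ ×-assoc-* (suc n) (+ 1 / suc n) q ⟨
  (suc n · (+ 1 / suc n)) ℚ.* q  ≡⟨ cong (λ r → r ℚ.* q) (unit-fraction-sum n) ⟩
  1ℚ ℚ.* q                       ≡⟨ ℚ.*-identityˡ q ⟩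
  q                              ∎
  where open Relation.Binary.PropositionalEquality.≡-Reasoning

unit-fraction-≤1 : ∀ n → + 1 / suc n ℚ.≤ 1ℚ
unit-fraction-≤1 n = begin
  + 1 / suc n            ≡⟨ ℚ.+-identityʳ (+ 1 / suc n) ⟨
  1 · (+ 1 / suc n)      ≤⟨ ·-monoˡ-≤ {1} {suc n} (unit-fraction-≥0 n) (s≤s z≤n) ⟩
  suc n · (+ 1 / suc n)  ≡⟨ unit-fraction-sum n ⟩
  1ℚ                     ∎
  where open ℚ.≤-Reasoning

*-nonNegative : ∀ {p q} → 0ℚ ℚ.≤ p → 0ℚ ℚ.≤ q → 0ℚ ℚ.≤ p ℚ.* q
*-nonNegative {p} {q} 0≤p 0≤q =
  ℚ.nonNegative⁻¹ (p ℚ.* q) ⦃ ℚ.nonNeg*nonNeg⇒nonNeg p ⦃ ℚ.nonNegative 0≤p ⦄ q ⦃ ℚ.nonNegative 0≤q ⦄ ⦄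

*-monoʳ-≤ℚ : ∀ {p q r} → 0ℚ ℚ.≤ r → p ℚ.≤ q → p ℚ.* r ℚ.≤ q ℚ.* r
*-monoʳ-≤ℚ {r = r} 0≤r = ℚ.*-monoʳ-≤-nonNeg r ⦃ ℚ.nonNegative 0≤r ⦄

convex : ∀ {m a b c} → 0ℚ ℚ.≤ m → m ℚ.≤ 1ℚ → c ℚ.≤ a → c ℚ.≤ b → c ℚ.≤ m ℚ.* a ℚ.+ (1ℚ ℚ.- m) ℚ.* b
convex {m} {a} {b} {c} 0≤m m≤1 c≤a c≤b = begin
  c                                      ≡⟨ lemma m c ⟩
  m ℚ.* c ℚ.+ (1ℚ ℚ.- m) ℚ.* c           ≤⟨ ℚ.+-mono-≤ (ℚ.*-monoˡ-≤-nonNeg m ⦃ ℚ.nonNegative 0≤m ⦄ c≤a)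
                                              (ℚ.*-monoˡ-≤-nonNeg (1ℚ ℚ.- m) ⦃ ℚ.nonNegative 0≤1-m ⦄ c≤b) ⟩
  m ℚ.* a ℚ.+ (1ℚ ℚ.- m) ℚ.* b           ∎
  where
  open ℚ.≤-Reasoning
  0≤1-m : 0ℚ ℚ.≤ 1ℚ ℚ.- m
  0≤1-m = ℚ.≤-trans (ℚ.≤-reflexive (sym (ℚ.+-inverseʳ m))) (ℚ.+-monoˡ-≤ (ℚ.- m) m≤1)
  lemma : ∀ m c → c ≡ m ℚ.* c ℚ.+ (1ℚ ℚ.- m) ℚ.* c
  lemma = solve 2 (λ m c → c := m :* c :+ (con 1ℚ :- m) :* c) refl
    where open +-*-Solver

-- Successive partial sums of e^x for −1 ≤ x ≤ 0 are convex combinations of the two preceding ones.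
expSum-≥ : ∀ m {c} → 0ℚ ℚ.≤ m → m ℚ.≤ 1ℚ → c ℚ.≤ 1ℚ ℚ.- m → ∀ n → c ℚ.≤ expSum (ℚ.- m) (2 + n)
expSum-≥ m {c} 0≤m m≤1 c≤1-m n = proj₁ (both n)
  where
  c≤1 : c ℚ.≤ 1ℚ
  c≤1 = ℚ.≤-trans c≤1-m (ℚ.≤-trans (ℚ.+-monoʳ-≤ 1ℚ (ℚ.neg-antimono-≤ 0≤m)) (ℚ.≤-reflexive (ℚ.+-identityʳ 1ℚ)))

  -- The term of index n + 1 is -m/(n + 1) times the term of index n, which is the difference of the
  -- two preceding sums. So the new sum goes back from the last one towards the one before by the
  -- fraction m/(n + 1).
  next : ∀ n → expSum (ℚ.- m) (2 + n) ≡
         m ℚ.* (+ 1 / suc n) ℚ.* expSum (ℚ.- m) n ℚ.+ (1ℚ ℚ.- m ℚ.* (+ 1 / suc n)) ℚ.* expSum (ℚ.- m) (1 + n)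
  next n = lemma (expSum (ℚ.- m) n) (expTerm (ℚ.- m) n) m (+ 1 / suc n)
    where
    open +-*-Solver
    lemma : ∀ s t m u → s ℚ.+ t ℚ.+ t ℚ.* (ℚ.- m ℚ.* u) ≡ m ℚ.* u ℚ.* s ℚ.+ (1ℚ ℚ.- m ℚ.* u) ℚ.* (s ℚ.+ t)
    lemma = solve 4 (λ s t m u → s :+ t :+ t :* (:- m :* u) := m :* u :* s :+ (con 1ℚ :- m :* u) :* (s :+ t)) refl

  combine : ∀ n → c ℚ.≤ expSum (ℚ.- m) n → c ℚ.≤ expSum (ℚ.- m) (1 + n) → c ℚ.≤ expSum (ℚ.- m) (2 + n)
  combine n c≤₀ c≤₁ = subst (c ℚ.≤_) (sym (next n)) (convex
    (*-nonNegative 0≤m (unit-fraction-≥0 n))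
    (ℚ.≤-trans (*-monoʳ-≤ℚ (unit-fraction-≥0 n) m≤1)
      (ℚ.≤-trans (ℚ.≤-reflexive (ℚ.*-identityˡ (+ 1 / suc n))) (unit-fraction-≤1 n)))
    c≤₀ c≤₁)

  both : ∀ n → c ℚ.≤ expSum (ℚ.- m) (2 + n) × c ℚ.≤ expSum (ℚ.- m) (1 + n)
  both zero    = subst (c ℚ.≤_) (lemma m) c≤1-m , subst (c ℚ.≤_) (sym (ℚ.+-identityˡ 1ℚ)) c≤1
    where
    open +-*-Solver
    lemma : ∀ m → 1ℚ ℚ.- m ≡ 0ℚ ℚ.+ 1ℚ ℚ.+ 1ℚ ℚ.* (ℚ.- m ℚ.* 1ℚ)
    lemma = solve 1 (λ m → con 1ℚ :- m := con 0ℚ :+ con 1ℚ :+ con 1ℚ :* (:- m :* con 1ℚ)) refl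
  both (suc n) = let (c≤₂ , c≤₁) = both n in combine (1 + n) c≤₁ c≤₂ , c≤₂

-- The constant 7/8 is the partial sum 1 + x at x = -1/8. All later partial sums stay above it, so
-- the estimate holds for each of them and not only in the limit.
ratio-≤ : ∀ K n → ratio K (2 + n) ℚ.≤ + 1 / 8 ℚ.* (+ 1 / suc ⌈log₂ K ⌉)
ratio-≤ K n = *-monoʳ-≤ℚ (unit-fraction-≥0 ⌈log₂ K ⌉) (begin
  1ℚ ℚ.- expSum (-[1+ 0 ] / 8) (2 + n)  ≤⟨ ℚ.+-monoʳ-≤ 1ℚ (ℚ.neg-antimono-≤ (expSum-≥ (+ 1 / 8) {+ 7 / 8}
                                             (ℚ.*≤* (ℤ.+≤+ z≤n)) (ℚ.*≤* (ℤ.+≤+ (s≤s z≤n))) ℚ.≤-refl n)) ⟩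
  1ℚ ℚ.- + 7 / 8                        ≡⟨⟩
  + 1 / 8                               ∎)
  where open ℚ.≤-Reasoning

ratio-scaled : ∀ K n {q p} → 0ℚ ℚ.≤ q → q ℚ.≤ suc ⌈log₂ K ⌉ · 8 · p → ratio K (2 + n) ℚ.* q ℚ.≤ p
ratio-scaled K n {q} {p} 0≤q q≤ = begin
  ratio K (2 + n) ℚ.* q                                  ≤⟨ *-monoʳ-≤ℚ 0≤q (ratio-≤ K n) ⟩
  + 1 / 8 ℚ.* (+ 1 / suc k) ℚ.* q                        ≡⟨ ℚ.*-assoc (+ 1 / 8) (+ 1 / suc k) q ⟩
  + 1 / 8 ℚ.* (+ 1 / suc k ℚ.* q)                        ≤⟨ ℚ.*-monoˡ-≤-nonNeg (+ 1 / 8)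
                                                              (ℚ.*-monoˡ-≤-nonNeg (+ 1 / suc k) ⦃ ℚ.normalize-nonNeg 1 (suc k) ⦄ q≤) ⟩
  + 1 / 8 ℚ.* (+ 1 / suc k ℚ.* (suc k · 8 · p))          ≡⟨ cong (λ r → + 1 / 8 ℚ.* r) (unit-fraction-cancel k (8 · p)) ⟩
  + 1 / 8 ℚ.* (8 · p)                                    ≡⟨ unit-fraction-cancel 7 p ⟩
  p                                                      ∎
  where
  open ℚ.≤-Reasoning
  k = ⌈log₂ K ⌉

-- Value of the computed schedule

does⁺ : ∀ {A : Set} (a? : Dec A) → A → T (does a?)
does⁺ a? a = subst T (sym (dec-true a? a)) tt

does⁻ : ∀ {A : Set} (a? : Dec A) → T (does a?) → A
does⁻ (yes a) _ = a

sumℚ-filter : ∀ {A : Set} {P : Pred A 0ℓ} (P? : Decidable P) (w : A → ℚ) xs →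
              sumℚ (map w (filter P? xs)) ≡ mass w (λ x → does (P? x)) xs
sumℚ-filter P? w []       = refl
sumℚ-filter P? w (x ∷ xs) with does (P? x)
... | true  = cong (λ a → w x ℚ.+ a) (sumℚ-filter P? w xs)
... | false = sumℚ-filter P? w xs

value-mass : ∀ I A → value I A ≡ mass weight (λ j → does (completes? A j)) (jobs I)
value-mass I A = sumℚ-filter (completes? A) weight (jobs I)

-- The p slots from max(r, t - l) onwards lie both in the block and in the window.
block-completes : ∀ {l t B} j → Stab (+ l) t (encodeJob j) →
                  (∀ {x} → t ℤ.- + l ℤ.≤ x → x ℤ.+ + 1 ℤ.≤ t → x ∈ B) → Completes B j
block-completes {l} {t} {B} j (stabs short wide early late) block
  with ℤ.≤-total (release j) (t ℤ.- + l)
... | inj₁ r≤t-l = card-≥ (t ℤ.- + l) (B ∩W j) λ {x} t-l≤x x< → ∈-filter⁺ (inWindow? j)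
  (block t-l≤x (≤-from (x ℤ.+ + 1) t (ℤ.+-mono-≤ x< short) (lemma₁ x t (+ l) (+ processing j))))
  (ℤ.≤-trans r≤t-l t-l≤x ,
   ≤-from x (deadline j) (ℤ.+-mono-≤ x< late) (lemma₂ x t (+ l) (+ processing j) (deadline j)))
  where
  lemma₁ : ∀ x t l p → t ℤ.- l ℤ.+ p ℤ.+ l ℤ.- (x ℤ.+ + 1 ℤ.+ p) ≡ t ℤ.- (x ℤ.+ + 1)
  lemma₁ = solve-∀
  lemma₂ : ∀ x t l p d → t ℤ.- l ℤ.+ p ℤ.+ (d ℤ.+ + 1 ℤ.+ l) ℤ.- (x ℤ.+ + 1 ℤ.+ (t ℤ.+ p)) ≡ d ℤ.- x
  lemma₂ = solve-∀
... | inj₂ t-l≤r = card-≥ (release j) (B ∩W j) λ {x} r≤x x< → ∈-filter⁺ (inWindow? j)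
  (block (ℤ.≤-trans t-l≤r r≤x) (ℤ.≤-trans x< early))
  (r≤x , ≤-from x (deadline j) (ℤ.≤-trans x< wide) (lemma x (deadline j)))
  where
  lemma : ∀ x d → d ℤ.+ + 1 ℤ.- (x ℤ.+ + 1) ≡ d ℤ.- x
  lemma = solve-∀

module _ (I : Instance) where

  private
    K : ℕ
    K = budget I

    js : List EJob
    js = map encodeJob (jobs I)

    0≤weight : ∀ {e} → e ∈ js → 0ℚ ℚ.≤ eweight e
    0≤weight e∈ = case ∈-map⁻ encodeJob e∈ of λ { (j , _ , refl) → weight-nonNegative j }

    module G (l : ℕ) = Greedy js 0≤weight l

  -- The stored weight omits jobs that are completed only by several blocks together, so it is a
  -- lower bound; the search compares these bounds. Blocks may overlap, and `length` counts a
  -- repeated slot each time, which bounds `card` from above.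
  Sound : ℚ × List ℤ → Set
  Sound (v , A) = length A ≤ K × v ℚ.≤ value I A

  covered⇒completed : ∀ l S j → T (covered (+ l) S (encodeJob j)) → Completes (G.blocks l S) j
  covered⇒completed l S j c = let (t , s , b) = find S c in block-completes j (stab⇒Stab (encodeJob j) s) b
    where
    Hit : List ℤ → Set
    Hit S = ∃[ t ] T (stab (+ l) t (encodeJob j)) × (∀ {x} → t ℤ.- + l ℤ.≤ x → x ℤ.+ + 1 ℤ.≤ t → x ∈ G.blocks l S)

    find : ∀ S → T (covered (+ l) S (encodeJob j)) → Hit S
    find (t ∷ S) c = split (stab (+ l) t (encodeJob j)) refl c
      where
      split : ∀ b → b ≡ stab (+ l) t (encodeJob j) → T (b ∨ covered (+ l) S (encodeJob j)) → Hit (t ∷ S)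
      split true  eq _ = t , subst T eq tt , ∈-emit t (G.blocks l S) l
      split false eq c = let (t′ , s , b) = find S c in t′ , s , λ ≤x x< → emit-⊇ t l (b ≤x x<)

  greedy-sound : ∀ l → Sound (greedy js (+ K) (+ l))
  greedy-sound l = subst (Sound ∘ proj₂) (sym is-state)
    (≤-trans (≤-reflexive (G.length-blocks l ends)) within , (begin
      G.gain l ends                                                  ≡⟨ G.gain-mass l ends ⟩
      mass eweight (covered (+ l) ends) js                           ≡⟨ mass-map eweight encodeJob _ (jobs I) ⟩
      mass weight (covered (+ l) ends ∘ encodeJob) (jobs I)          ≤⟨ mass-mono weight _ _ (jobs I) (λ {j} _ → weight-nonNegative j)
                                                                          (λ {j} _ c → does⁺ (completes? (G.blocks l ends) j) (covered⇒completed l ends j c)) ⟩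
      mass weight (λ j → does (completes? (G.blocks l ends) j)) (jobs I)  ≡⟨ value-mass I (G.blocks l ends) ⟨
      value I (G.blocks l ends)                                      ∎))
    where
    open ℚ.≤-Reasoning
    open G.Run l (G.run l K K)

  improve-spec : ∀ s → let L = + 1 ℤ.+ proj₁ s ; b = proj₂ s ; b′ = proj₂ (improve js (+ K) s) in
    (Sound b → Sound (greedy js (+ K) L) → Sound b′) ×
    proj₁ b ℚ.≤ proj₁ b′ × proj₁ (greedy js (+ K) L) ℚ.≤ proj₁ b′
  improve-spec (L , b) = by (proj₁ g ℚ.≤? proj₁ b)
    where
    g = greedy js (+ K) (+ 1 ℤ.+ L)
    by : (g≤b? : Dec (proj₁ g ℚ.≤ proj₁ b)) → let b′ = if does g≤b? then b else g in
         (Sound b → Sound g → Sound b′) × proj₁ b ℚ.≤ proj₁ b′ × proj₁ g ℚ.≤ proj₁ b′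
    by (yes g≤b) = (λ b-sound _ → b-sound) , ℚ.≤-refl , g≤b
    by (no g≰b)  = (λ _ g-sound → g-sound) , ℚ.<⇒≤ (ℚ.≰⇒> g≰b) , ℚ.≤-refl

  found : ℕ → ℚ × List ℤ
  found n = proj₂ (search js (+ K) n)

  search-sound : ∀ n → Sound (found n)
  search-sound zero    = z≤n , subst (0ℚ ℚ.≤_) (sym (value-mass I []))
                           (mass-nonNegative weight _ (jobs I) (λ {j} _ → weight-nonNegative j))
  search-sound (suc n) = proj₁ (improve-spec (search js (+ K) n)) (search-sound n)
    (subst (λ L → Sound (greedy js (+ K) (+ 1 ℤ.+ L))) (sym (search-length js (+ K) n)) (greedy-sound (suc n)))

  greedy-≤-search : ∀ n {m} → m < n → proj₁ (greedy js (+ K) (+ suc m)) ℚ.≤ proj₁ (found n)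
  greedy-≤-search (suc n) {m} m<1+n = by (m<1+n⇒m<n∨m≡n m<1+n)
    where
    s = search js (+ K) n
    by : m < n ⊎ m ≡ n → proj₁ (greedy js (+ K) (+ suc m)) ℚ.≤ proj₁ (found (suc n))
    by (inj₁ m<n)  = ℚ.≤-trans (greedy-≤-search n m<n) (proj₁ (proj₂ (improve-spec s)))
    by (inj₂ m≡n) = subst (λ L → proj₁ (greedy js (+ K) (+ 1 ℤ.+ L)) ℚ.≤ proj₁ (found (suc n)))
      (trans (search-length js (+ K) n) (cong (λ k → + k) (sym m≡n))) (proj₂ (proj₂ (improve-spec s)))

  -- The number of greedy blocks is known only from the run, so the condition on `Q` is imposed for
  -- every `k` that a run of `K` rounds can produce.
  greedy-approximation : ∀ {l} → 1 ≤ l → l ≤ K → ∀ Q → (∀ k → 1 ≤ k → k ≡ K ⊎ K < l + k ℕ.* l → length Q ≤ 7 ℕ.* k) →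
    mass eweight (covered (+ l) Q) js ℚ.≤ 8 · proj₁ (solution I)
  greedy-approximation {l@(suc l′)} _ l≤K Q ∣Q∣≤ = begin
    mass eweight (covered (+ l) Q) js          ≤⟨ G.picked-approximation l picked Q (∣Q∣≤ (length ends) 1≤ exhaustive) ⟩
    8 · G.gain l ends                          ≡⟨ cong (λ s → 8 · proj₁ (proj₂ s)) is-state ⟨
    8 · proj₁ (greedy js (+ K) (+ l))          ≤⟨ ·-monoʳ-≤ 8 (greedy-≤-search K l≤K) ⟩
    8 · proj₁ (found K)                        ∎
    where
    open ℚ.≤-Reasoning
    open G.Run l (G.run l K K)
    -- A first block fits because `l ≤ K`; `few-points` uses it to absorb an additive constant.
    1≤ : 1 ≤ length ends
    1≤ = case exhaustive of λ
      { (inj₁ ≡K) → subst (1 ≤_) (sym ≡K) (≤-trans (s≤s z≤n) l≤K)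
      ; (inj₂ K<) → positive (length ends) K< }
      where
      positive : ∀ k → K < l + k ℕ.* l → 1 ≤ k
      positive zero    K< = contradiction (subst (K <_) (+-identityʳ l) K<) (≤⇒≯ l≤K)
      positive (suc k) _  = s≤s z≤n

-- Comparison with an optimal set

module Optimum (A : Slots) where

  B : List ℤ
  B = sort (deduplicate ℤ._≟_ A)

  length-B : length B ≡ card A
  length-B = ↭-length (sort-↭ (deduplicate ℤ._≟_ A))

  A⊆B : ∀ {x} → x ∈ A → x ∈ B
  A⊆B x∈A = ∈-resp-↭ (↭-sym (sort-↭ _)) (∈-deduplicate⁺ ℤ._≟_ x∈A)

  fromRight fromLeft : ℤ → ℕ
  fromRight q = length (filter (q ℤ.≤?_) B)
  fromLeft  q = length (filter (¬? ∘ (q ℤ.≤?_)) B)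

  -- The slots of `A` that complete `j` are counted on either side of `q`. Being distinct, on each
  -- side they are at most as many as the slots of the window there and the slots of `A` there. The
  -- placement of blocks depends on these counts alone.
  record Crossing (j : Job) (q : ℤ) : Set where
    field
      before after : ℕ
      enough       : processing j ≤ after + before
      before≤      : before ≤ fromLeft q
      after≤       : after ≤ fromRight q
      before-fits  : release j ℤ.+ + before ℤ.≤ q
      after-fits   : q ℤ.+ + after ℤ.≤ deadline j ℤ.+ + 1

  crossing : ∀ {j q} → Completes A j → InWindow j q → Crossing j q
  crossing {j} {q} done (r≤q , q≤d) = record
    { before      = length (filter (¬? ∘ (q ℤ.≤?_)) F)
    ; after       = length (filter (q ℤ.≤?_) F)
    ; enough      = ≤-trans done (≤-reflexive (sym (length-filter-split (q ℤ.≤?_) F)))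
    ; before≤     = unique-⊆⇒length-≤ (Unique.filter⁺ (¬? ∘ (q ℤ.≤?_)) F!) λ x∈ →
        let (x∈F , q≰x) = ∈-filter⁻ (¬? ∘ (q ℤ.≤?_)) x∈ in
        ∈-filter⁺ (¬? ∘ (q ℤ.≤?_)) (A⊆B (proj₁ (F⊆ x∈F))) q≰x
    ; after≤      = unique-⊆⇒length-≤ (Unique.filter⁺ (q ℤ.≤?_) F!) λ x∈ →
        let (x∈F , q≤x) = ∈-filter⁻ (q ℤ.≤?_) x∈ in
        ∈-filter⁺ (q ℤ.≤?_) (A⊆B (proj₁ (F⊆ x∈F))) q≤x
    ; before-fits = unique-length-≤ (Unique.filter⁺ (¬? ∘ (q ℤ.≤?_)) F!) r≤q λ x∈ →
        let (x∈F , q≰x) = ∈-filter⁻ (¬? ∘ (q ℤ.≤?_)) x∈ in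
        proj₁ (proj₂ (F⊆ x∈F)) , <⇒+1≤ (ℤ.≰⇒> q≰x)
    ; after-fits  = unique-length-≤ (Unique.filter⁺ (q ℤ.≤?_) F!) (ℤ.≤-trans q≤d (ℤ.i≤i+j (deadline j) (+ 1))) λ x∈ →
        let (x∈F , q≤x) = ∈-filter⁻ (q ℤ.≤?_) x∈ in
        q≤x , ℤ.+-monoˡ-≤ (+ 1) (proj₂ (proj₂ (F⊆ x∈F)))
    }
    where
    F : List ℤ
    F = deduplicate ℤ._≟_ (A ∩W j)

    F! : Unique F
    F! = deduplicate-! (A ∩W j)

    F⊆ : ∀ {x} → x ∈ F → x ∈ A × InWindow j x
    F⊆ x∈F = ∈-filter⁻ (inWindow? j) (∈-deduplicate⁻ ℤ._≟_ (A ∩W j) x∈F)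

  points : ℕ → List ℤ
  points p = every p p B

  length-points : ∀ p → length (points p) ℕ.* suc p ≤ card A
  length-points p = subst (length (points p) ℕ.* suc p ≤_) length-B
    (+-cancelʳ-≤ p _ _ (length-every p p B ≤-refl))

  points-hit : ∀ p j → Completes A j → p < processing j → ∃[ q ] q ∈ points p × InWindow j q
  points-hit p j done p< = every-hits j p p (Sorted⇒AllPairs ℤ.≤-totalOrder (sort-↗ _)) (inj₁ (many , ≤-refl))
    where
    many : p < length (B ∩W j)
    many = <-≤-trans p< (≤-trans done (unique-⊆⇒length-≤ (deduplicate-! (A ∩W j)) λ x∈ →
      let (x∈A , xj) = ∈-filter⁻ (inWindow? j) (∈-deduplicate⁻ ℤ._≟_ (A ∩W j) x∈) in
      ∈-filter⁺ (inWindow? j) (A⊆B x∈A) xj))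

  window-≥ : ∀ {j q} → Crossing j q → release j ℤ.+ + processing j ℤ.≤ deadline j ℤ.+ + 1
  window-≥ {j} {q} c = ≤-from _ _ (ℤ.+-mono-≤ (ℤ.+-mono-≤ before-fits after-fits) (ℤ.+≤+ enough))
    (lemma (release j) (deadline j) q (+ before) (+ after) (+ processing j))
    where
    open Crossing c
    lemma : ∀ r d q a b p → q ℤ.+ (d ℤ.+ + 1) ℤ.+ (b ℤ.+ a) ℤ.- (r ℤ.+ a ℤ.+ (q ℤ.+ b) ℤ.+ p) ≡
                            d ℤ.+ + 1 ℤ.- (r ℤ.+ p)
    lemma = solve-∀

  -- The block {q - 2P, ..., q + 2P - 1} extends 2P ≥ p slots to each side of `q`, so a window of at
  -- least p slots around `q` meets it in p consecutive slots. This is where the length 4P comes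
  -- from.
  centred-stab : ∀ {j q} P → Crossing j q → InWindow j q → processing j ≤ 2 ℕ.* P →
                 Stab (+ (4 ℕ.* P)) (q ℤ.+ + (2 ℕ.* P)) (encodeJob j)
  centred-stab {j} {q} P c (r≤q , q≤d) p≤2P = record
    { short = ℤ.+≤+ (≤-trans p≤2P (*-monoˡ-≤ P {2} {4} (s≤s (s≤s z≤n))))
    ; wide  = window-≥ c
    ; early = ℤ.+-mono-≤ r≤q (ℤ.+≤+ p≤2P)
    ; late  = ≤-from (q ℤ.+ + (2 ℕ.* P) ℤ.+ + processing j) (deadline j ℤ.+ + 1 ℤ.+ + (4 ℕ.* P))
        (ℤ.+-mono-≤ (ℤ.+-mono-≤ q≤d (ℤ.+≤+ p≤2P)) (ℤ.+≤+ doubled)) (lemma q (+ processing j) (+ (2 ℕ.* P)) (deadline j) (+ (4 ℕ.* P)))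
    }
    where
    doubled : 2 ℕ.* P + 2 ℕ.* P ≤ suc (4 ℕ.* P)
    doubled = ≤-trans (≤-reflexive (sym (*-distribʳ-+ P 2 2))) (n≤1+n (4 ℕ.* P))
    lemma : ∀ q p P₂ d P₄ → d ℤ.+ P₂ ℤ.+ (+ 1 ℤ.+ P₄) ℤ.- (q ℤ.+ p ℤ.+ (P₂ ℤ.+ P₂)) ≡
                            d ℤ.+ + 1 ℤ.+ P₄ ℤ.- (q ℤ.+ P₂ ℤ.+ p)
    lemma = solve-∀

  -- The block of length K that has as many slots before q as A: pushing the slots
  -- of A together towards q keeps them in every window containing q.
  compressed-stab : ∀ {j q} K → card A ≤ K → Crossing j q → processing j ≤ K →
                    Stab (+ K) (q ℤ.+ + fromRight q) (encodeJob j)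
  compressed-stab {j} {q} K ∣A∣≤K c p≤K = record
    { short = ℤ.+≤+ p≤K
    ; wide  = window-≥ c
    ; early = ≤-from (release j ℤ.+ + processing j) (q ℤ.+ + fromRight q)
        (ℤ.+-mono-≤ before-fits (ℤ.+≤+ (≤-trans enough (+-monoˡ-≤ before after≤))))
        (lemma₁ (release j) q (+ processing j) (+ before) (+ fromRight q))
    ; late  = ≤-from (q ℤ.+ + fromRight q ℤ.+ + processing j) (deadline j ℤ.+ + 1 ℤ.+ + K)
        (ℤ.+-mono-≤ after-fits (ℤ.+≤+ total))
        (lemma₂ (deadline j) q (+ processing j) (+ after) (+ fromRight q) (+ K))
    }
    where
    open Crossing c
    lemma₁ : ∀ r q p a R → q ℤ.+ (R ℤ.+ a) ℤ.- (r ℤ.+ a ℤ.+ p) ≡ q ℤ.+ R ℤ.- (r ℤ.+ p)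
    lemma₁ = solve-∀
    lemma₂ : ∀ d q p b R K → d ℤ.+ + 1 ℤ.+ (b ℤ.+ K) ℤ.- (q ℤ.+ b ℤ.+ (p ℤ.+ R)) ≡
                             d ℤ.+ + 1 ℤ.+ K ℤ.- (q ℤ.+ R ℤ.+ p)
    lemma₂ = solve-∀
    total : processing j + fromRight q ≤ after + K
    total = begin
      processing j + fromRight q               ≤⟨ +-monoˡ-≤ (fromRight q) (≤-trans enough (+-monoʳ-≤ after before≤)) ⟩
      after + fromLeft q + fromRight q         ≡⟨ +-assoc after (fromLeft q) (fromRight q) ⟩
      after + (fromLeft q + fromRight q)       ≡⟨ cong (λ n → after + n) (+-comm (fromLeft q) (fromRight q)) ⟩
      after + (fromRight q + fromLeft q)       ≡⟨ cong (λ n → after + n) (trans (length-filter-split (q ℤ.≤?_) B) length-B) ⟩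
      after + card A                           ≤⟨ +-monoʳ-≤ after ∣A∣≤K ⟩
      after + K                                ∎
      where open ≤-Reasoning

  covered-map : ∀ (f : ℤ → ℤ) L j {q Q} → q ∈ Q → Stab L (f q) j → T (covered L (map f Q) j)
  covered-map f L j {Q = q ∷ Q} (here refl) s = or-left (Stab⇒stab j s)
    where
    or-left : ∀ {a b} → T a → T (a ∨ b)
    or-left {true} _ = tt
  covered-map f L j {Q = q′ ∷ Q} (there q∈) s = or-right (stab L (f q′) j) (covered-map f L j q∈ s)
    where
    or-right : ∀ a {b} → T b → T (a ∨ b)
    or-right true  _ = tt
    or-right false b = b

-- Write P′ for `suc P`. If no further block fits, then n·P′ ≤ K < (k + 1)·l ≤ 4P′·(k + 1), hence n
-- ≤ 4k + 3, and k ≥ 1 turns this into 7k. If every round placed a block, then n ≤ K = k already.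
few-points : ∀ K P l k n → 1 ≤ k → n ℕ.* suc P ≤ K → k ≡ K ⊎ K < l + k ℕ.* l → l ≤ 4 ℕ.* suc P → n ≤ 7 ℕ.* k
few-points K P l k n 1≤k nP≤K (inj₁ refl) l≤4P = begin
  n              ≤⟨ m≤m*n n (suc P) ⟩
  n ℕ.* suc P    ≤⟨ nP≤K ⟩
  k              ≤⟨ m≤n*m k 7 ⟩
  7 ℕ.* k        ∎
  where open ≤-Reasoning
few-points K P l k n 1≤k nP≤K (inj₂ K<) l≤4P = begin
  n                      ≤⟨ s≤s⁻¹ (subst (n <_) (*-suc 4 k) (*-cancelʳ-< (suc P) n (4 ℕ.* suc k) n<)) ⟩
  3 + 4 ℕ.* k            ≤⟨ +-monoˡ-≤ (4 ℕ.* k) (*-monoʳ-≤ 3 1≤k) ⟩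
  3 ℕ.* k + 4 ℕ.* k      ≡⟨ *-distribʳ-+ k 3 4 ⟨
  7 ℕ.* k                ∎
  where
  open ≤-Reasoning
  n< : n ℕ.* suc P < 4 ℕ.* suc k ℕ.* suc P
  n< = begin-strict
    n ℕ.* suc P                  ≤⟨ nP≤K ⟩
    K                            <⟨ K< ⟩
    suc k ℕ.* l                  ≤⟨ *-monoʳ-≤ (suc k) l≤4P ⟩
    suc k ℕ.* (4 ℕ.* suc P)      ≡⟨ *-assoc (suc k) 4 (suc P) ⟨
    suc k ℕ.* 4 ℕ.* suc P        ≡⟨ cong (ℕ._* suc P) (*-comm (suc k) 4) ⟩
    4 ℕ.* suc k ℕ.* suc P        ∎

-- Summation over the classes of processing times

module _ (I : Instance) (A : Slots) (feasible : card A ≤ budget I) where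

  open Optimum A

  private
    K : ℕ
    K = budget I

    v : ℚ
    v = proj₁ (solution I)

  processing-≤ : ∀ j → Completes A j → processing j ≤ K
  processing-≤ j done = ≤-trans (≤-trans done (unique-⊆⇒length-≤ {ys = deduplicate ℤ._≟_ A} (deduplicate-! (A ∩W j)) λ x∈ →
    ∈-deduplicate⁺ ℤ._≟_ (proj₁ (∈-filter⁻ (inWindow? j) (∈-deduplicate⁻ ℤ._≟_ (A ∩W j) x∈))))) feasible

  cover : ∀ p → ∃[ l ] ∃[ Q ] 1 ≤ l × l ≤ K × l ≤ 4 ℕ.* suc p × length Q ≡ length (points p) ×
          (∀ j → Completes A j → p < processing j → processing j ≤ 2 ℕ.* suc p →
           T (covered (+ l) Q (encodeJob j)))
  cover p with 4 ℕ.* suc p ≤? K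
  ... | yes 4P≤K = 4 ℕ.* suc p , map centre (points p) , s≤s z≤n , 4P≤K , ≤-refl , length-map centre (points p) ,
    λ j done p< ≤2P → let (q , q∈ , qj) = points-hit p j done p< in
      covered-map centre (+ (4 ℕ.* suc p)) (encodeJob j) q∈ (centred-stab (suc p) (crossing {j} {q} done qj) qj ≤2P)
    where
    centre : ℤ → ℤ
    centre q = q ℤ.+ + (2 ℕ.* suc p)
  -- A centred block of length `K` would extend only K/2 to either side, which may be less than the
  -- processing time. The block is therefore shifted according to the number of slots of `A` to the
  -- right of the point.
  ... | no 4P≰K = K , map right (points p) , >-nonZero⁻¹ K ⦃ budget-positive I ⦄ , ≤-refl , <⇒≤ (≰⇒> 4P≰K) ,
    length-map right (points p) ,
    λ j done p< _ → let (q , q∈ , qj) = points-hit p j done p< in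
      covered-map right (+ K) (encodeJob j) q∈ (compressed-stab K feasible (crossing {j} {q} done qj) (processing-≤ j done))
    where
    right : ℤ → ℤ
    right q = q ℤ.+ + fromRight q

  completesShort? : ∀ n j → Dec (Completes A j × processing j < n)
  completesShort? n j = completes? A j ×-dec (processing j <? n)

  -- Thresholds replace the classes: doubling the threshold adds one class, so the sum over the
  -- classes becomes an induction on the exponent.
  shortValue : ℕ → ℚ
  shortValue n = mass weight (λ j → does (completesShort? n j)) (jobs I)

  shortValue-double : ∀ p → shortValue (2 ℕ.* suc p) ℚ.≤ 8 · v ℚ.+ shortValue (suc p)
  shortValue-double p with cover p
  ... | l , Q , 1≤l , l≤K , l≤4P , ∣Q∣ , covers = begin
    shortValue (2 ℕ.* suc p)                                                 ≤⟨ mass-cover weight _ (covered (+ l) Q ∘ encodeJob) _ (jobs I)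
                                                                                  (λ {j} _ → weight-nonNegative j) (λ {j} _ → long⊎short j) ⟩
    mass weight (covered (+ l) Q ∘ encodeJob) (jobs I) ℚ.+ shortValue (suc p) ≡⟨ cong (λ a → a ℚ.+ shortValue (suc p)) (mass-map eweight encodeJob (covered (+ l) Q) (jobs I)) ⟨
    mass eweight (covered (+ l) Q) (map encodeJob (jobs I)) ℚ.+ shortValue (suc p)
                                                                             ≤⟨ ℚ.+-monoˡ-≤ (shortValue (suc p)) (greedy-approximation I 1≤l l≤K Q few) ⟩
    8 · v ℚ.+ shortValue (suc p)                                             ∎
    where
    open ℚ.≤-Reasoning
    few : ∀ k → 1 ≤ k → k ≡ K ⊎ K < l + k ℕ.* l → length Q ≤ 7 ℕ.* k
    few k 1≤k ex = few-points K p l k (length Q) 1≤k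
      (subst (λ n → n ℕ.* suc p ≤ K) (sym ∣Q∣) (≤-trans (length-points p) feasible)) ex l≤4P
    long⊎short : ∀ j → T (does (completesShort? (2 ℕ.* suc p) j)) →
                 T (covered (+ l) Q (encodeJob j)) ⊎ T (does (completesShort? (suc p) j))
    long⊎short j h = let (done , p<) = does⁻ (completesShort? (2 ℕ.* suc p) j) h in
      case processing j <? suc p of λ
        { (yes short) → inj₂ (does⁺ (completesShort? (suc p) j) (done , short))
        ; (no long)   → inj₁ (covers j done (≮⇒≥ long) (<⇒≤ p<)) }

  shortValue-≤ : ∀ i → shortValue (2 ^ i) ℚ.≤ i · 8 · v
  shortValue-≤ zero    = ℚ.≤-reflexive (none (jobs I))
    where
    none : ∀ js → mass weight (λ j → does (completesShort? 1 j)) js ≡ 0ℚ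
    none []       = refl
    none (j ∷ js) = trans (cong (λ b → if b then weight j ℚ.+ mass weight (λ j → does (completesShort? 1 j)) js
                                            else mass weight (λ j → does (completesShort? 1 j)) js)
      (dec-false (completesShort? 1 j) λ (_ , p<1) → <⇒≱ p<1 (>-nonZero⁻¹ (processing j) ⦃ processing-positive j ⦄))) (none js)
  shortValue-≤ (suc i) = begin
    shortValue (2 ^ suc i)              ≡⟨ cong (λ n → shortValue (2 ℕ.* n)) 2^i ⟨
    shortValue (2 ℕ.* suc p)            ≤⟨ shortValue-double p ⟩
    8 · v ℚ.+ shortValue (suc p)        ≡⟨ cong (λ n → 8 · v ℚ.+ shortValue n) 2^i ⟩
    8 · v ℚ.+ shortValue (2 ^ i)        ≤⟨ ℚ.+-monoʳ-≤ (8 · v) (shortValue-≤ i) ⟩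
    8 · v ℚ.+ i · 8 · v                 ∎
    where
    open ℚ.≤-Reasoning
    p : ℕ
    p = pred (2 ^ i)
    2^i : suc p ≡ 2 ^ i
    2^i = suc-pred (2 ^ i) ⦃ m^n≢0 2 i ⦄

  value-≤ : value I A ℚ.≤ suc ⌈log₂ K ⌉ · 8 · v
  value-≤ = begin
    value I A                                               ≡⟨ value-mass I A ⟩
    mass weight (λ j → does (completes? A j)) (jobs I)      ≤⟨ mass-mono weight _ _ (jobs I) (λ {j} _ → weight-nonNegative j) (λ {j} _ → all-short j) ⟩
    shortValue (2 ^ suc ⌈log₂ K ⌉)                          ≤⟨ shortValue-≤ (suc ⌈log₂ K ⌉) ⟩
    suc ⌈log₂ K ⌉ · 8 · v                                   ∎
    where
    open ℚ.≤-Reasoning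
    -- The threshold is strict, so the exponent ⌈log₂ K⌉ alone would miss the jobs with p_j = K when
    -- K is a power of two.
    all-short : ∀ j → T (does (completes? A j)) → T (does (completesShort? (2 ^ suc ⌈log₂ K ⌉) j))
    all-short j h = let done = does⁻ (completes? A j) h in
      does⁺ (completesShort? (2 ^ suc ⌈log₂ K ⌉) j) (done ,
        ≤-<-trans (≤-trans (processing-≤ j done) (n≤2^⌈log₂n⌉ K)) (^-monoʳ-< 2 (s≤s (s≤s z≤n)) (n<1+n ⌈log₂ K ⌉)))

theorem2 : ∃[ alg ] PolynomialTime alg
    × (∀ I → Feasible I (output alg I)
    × (∀ opt → IsOPT I opt →
    Lim (λ N → ratio (budget I) N * opt) ≤ value I (output alg I)))
theorem2 = algorithm , algorithm-polynomialTime , λ I →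
  let K = budget I ; (short , v≤) = search-sound I K in
  -- `output algorithm I` reduces to `proj₂ (solution I)`, so nothing remains to be shown about the
  -- interpreter.
  ≤-trans (length-deduplicate ℤ._≟_ (proj₂ (solution I))) short ,
  -- From two terms of the exponential series on, the inequality holds even without ε.
  λ { opt ((A , feasible , refl) , _) ε 0<ε → 2 , λ
    { (suc (suc n)) _ → ℚ.≤-trans
        (ratio-scaled K n
          (subst (0ℚ ℚ.≤_) (sym (value-mass I A)) (mass-nonNegative weight _ (jobs I) (λ {j} _ → weight-nonNegative j)))
          (value-≤ I A feasible))
        (ℚ.≤-trans v≤ (ℚ.≤-trans (ℚ.≤-reflexive (sym (ℚ.+-identityʳ _))) (ℚ.+-monoʳ-≤ (value I (proj₂ (solution I))) (ℚ.<⇒≤ 0<ε))))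
    ; (suc zero) (s≤s ()) } }
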